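{- For an irreducible, positive recurrent Markov chain $\{X_t\}$ with countable state space $\Sigma$ and transition probability matrix $P$, and for any $i\in\Sigma$ and $k\in\mathbb Z_+$, $$\frac{1-\mathbb P_i(T_i>\theta^{(k)})}{\mathbb E_i[\hat T_i^{(k)}]}-\pi_i=\frac{\mathbb P_i(T_i>\theta^{(k)})}{\mathbb E_i[\hat T_i^{(k)}]}\left(\Gamma_i(\theta^{(k)})-1\right),$$ where $$\Gamma_i(\theta)=\sum_{q\in\Sigma\setminus\{i\}}\mathbb P_i\left(X_\theta=q\mid T_i>\theta\right)(Z_{ii}-Z_{qi}).$$
   Context: $\mathbb P_i(\cdot)=\mathbb P(\cdot\mid X_0=i)$ and $\mathbb E_i[\cdot]=\mathbb E[\cdot\mid X_0=i]$; $T_i=\inf\{t\ge1:X_t=i\}$; $\pi$ is the unique stationary distribution; $\mathbb Z_+$ denotes the positive integers and $k$ is an iteration index. $\theta^{(k)}=2^k$ is the truncation threshold at iteration $k$, and $\hat T_i^{(k)}$ is the sample average of independent copies of $\min(T_i,\theta^{(k)})$ (chain started at $i$) collected at iteration $k$, so that $\mathbb E_i[\hat T_i^{(k)}]=\mathbb E_i[\min(T_i,\theta^{(k)})]$. $Z$ is the fundamental matrix, with entries $Z_{jl}=\sum_{t=0}^\infty(P^t_{jl}-\pi_l)$, where $P^t_{jl}$ is the $(j,l)$ entry of $P^t$.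
   Formalization: The series defining the entries Z_{ji} (all j, fixed i) are assumed to converge; for some irreducible positive recurrent chains (e.g. the periodic two-state chain) they diverge and Z, hence Γ_i, is undefined. -}

module Defs where

open import Algebra.Bundles using (CommutativeRing; RawMonoid)
import Algebra.Definitions.RawMonoid as RawMonoidDefinitions
open import Axiom.ExcludedMiddle using (ExcludedMiddle)
open import Data.Bool.Base using (if_then_else_)
open import Data.Fin.Base using (Fin; toℕ)
open import Data.List.Base using (List; []; _∷_; map; foldr)
open import Data.List.Relation.Binary.Subset.Propositional using () renaming (_⊆_ to _⊆ˡ_)
open import Data.List.Relation.Unary.All using (All)
open import Data.List.Relation.Unary.Unique.Propositional using (Unique)
open import Data.Nat.Base as ℕ using (ℕ; zero; suc)
open import Data.Product.Base using (Σ; ∃; _,_; proj₁; proj₂) renaming (_×_ to _∧_)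
open import Function.Base using (_∘_)
open import Function.Bundles using (_↣_)
open import Level using (0ℓ; Lift; lift; lower) renaming (suc to lsuc)
import Relation.Binary.Construct.Add.Supremum.NonStrict as SupremumNonStrict
import Relation.Binary.Construct.Add.Supremum.Strict as SupremumStrict
import Relation.Binary.Construct.NonStrictToStrict as NonStrictToStrict
open import Relation.Binary.Core using (Rel)
open import Relation.Binary.PropositionalEquality.Core using (_≡_; _≢_)
open import Relation.Binary.Structures using (IsTotalOrder)
open import Relation.Nullary.Construct.Add.Supremum using (_⁺; [_]; ⊤⁺)
open import Relation.Nullary.Decidable.Core using (Dec; does; yes; no; map′)
open import Relation.Nullary.Negation.Core using (¬_)
open import Relation.Unary using (Pred; Satisfiable; U; ∁; ⋃; ⋂; _∩_; _≐_)

-- The real numbers are taken axiomatically, as a Dedekind-complete ordered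
-- field; classically this determines them up to unique isomorphism.
-- Inversion is total, with the convention 0 ⁻¹ = 0.

record CompleteOrderedField : Set₁ where
  infix 8 _⁻¹
  infixl 7 _/_
  infix 4 _≤_ _<_
  field
    commutativeRing : CommutativeRing 0ℓ 0ℓ

  open CommutativeRing commutativeRing public renaming (Carrier to ℝ)

  field
    1≉0          : ¬ (1# ≈ 0#)
    _⁻¹          : ℝ → ℝ
    ⁻¹-cong      : ∀ {x y} → x ≈ y → x ⁻¹ ≈ y ⁻¹
    ⁻¹-inverse   : ∀ x → ¬ (x ≈ 0#) → x * x ⁻¹ ≈ 1#
    0⁻¹≈0        : 0# ⁻¹ ≈ 0#
    _≤_          : Rel ℝ 0ℓ
    isTotalOrder : IsTotalOrder _≈_ _≤_
    +-monoˡ-≤    : ∀ z {x y} → x ≤ y → x + z ≤ y + z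
    *-nonNeg     : ∀ {x y} → 0# ≤ x → 0# ≤ y → 0# ≤ x * y

  IsUpperBound : ∀ {ℓ} → Pred ℝ ℓ → Pred ℝ ℓ
  IsUpperBound A b = ∀ x → A x → x ≤ b

  IsSupremum : ∀ {ℓ} → Pred ℝ ℓ → Pred ℝ ℓ
  IsSupremum A s = IsUpperBound A s ∧ (∀ b → IsUpperBound A b → s ≤ b)

  field
    complete : (A : Pred ℝ 0ℓ) → Satisfiable A → ∃ (IsUpperBound A) → ∃ (IsSupremum A)

  _<_ : Rel ℝ 0ℓ
  _<_ = NonStrictToStrict._<_ _≈_ _≤_

  _/_ : ℝ → ℝ → ℝ
  x / y = x * y ⁻¹

  open RawMonoidDefinitions +-rawMonoid public using (sum; _×_)
  open RawMonoidDefinitions *-rawMonoid public using () renaming (sum to product)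

  fromℕ : ℕ → ℝ
  fromℕ n = n × 1#

-- The set S may be finite or countably infinite.

Countable : Set → Set
Countable S = S ↣ ℕ

-- Excluded middle is a parameter so that sums, expectations and hitting times
-- can be total functions with values at points where they would be undefined
-- (a divergent sum is 0).  The level is that of
-- statements quantifying over finite families of events.

module Theory (em : ExcludedMiddle (lsuc 0ℓ)) (R : CompleteOrderedField) where

  open CompleteOrderedField R
  open SupremumNonStrict _≤_ using (_≤⁺_)
  open SupremumStrict _<_ using (_<⁺_)
  open SupremumStrict ℕ._<_ using () renaming (_<⁺_ to _<∞_)

  decide : (A : Set) → Dec A
  decide A = map′ lower lift (em {Lift (lsuc 0ℓ) A})

  𝟙 : {I : Set} → Pred I 0ℓ → I → ℝ
  𝟙 A x = if does (decide (A x)) then 1# else 0#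

  ----------------------------------------------------------------------
  -- Convergence

  Near : ℝ → ℝ → ℝ → Set
  Near ε x y = (x - ε < y) ∧ (y < x + ε)

  _⟶_ : (ℕ → ℝ) → ℝ → Set
  s ⟶ l = ∀ ε → 0# < ε → ∃ λ N → ∀ n → N ℕ.≤ n → Near ε l (s n)

  HasSeries : (ℕ → ℝ) → ℝ → Set
  HasSeries f s = (λ n → sum {n} (f ∘ toℕ)) ⟶ s

  Convergent : (ℕ → ℝ) → Set
  Convergent f = ∃ (HasSeries f)

  series : (ℕ → ℝ) → ℝ
  series f with decide (Convergent f)
  ... | yes (s , _) = s
  ... | no _        = 0#

  -- Sums over an index set without a preferred order are unconditional:
  -- limits along the finite subsets, which are given by repetition-free lists.

  sumOver : {I : Set} → List I → (I → ℝ) → ℝ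
  sumOver xs f = foldr _+_ 0# (map f xs)

  HasSum : {I : Set} → (I → ℝ) → ℝ → Set
  HasSum {I} f s = ∀ ε → 0# < ε →
    Σ (List I) λ xs → ∀ ys → Unique ys → xs ⊆ˡ ys → Near ε s (sumOver ys f)

  Summable : {I : Set} → (I → ℝ) → Set
  Summable f = ∃ (HasSum f)

  ∑ : {I : Set} → (I → ℝ) → ℝ
  ∑ f with decide (Summable f)
  ... | yes (s , _) = s
  ... | no _        = 0#

  ----------------------------------------------------------------------
  -- Probability

  record MeasurableSpace : Set₁ where
    field
      Ω            : Set
      Measurable   : Pred (Pred Ω 0ℓ) 0ℓ
      measurable-≐ : ∀ {A B} → A ≐ B → Measurable A → Measurable B
      measurable-U : Measurable U
      measurable-∁ : ∀ {A} → Measurable A → Measurable (∁ A)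
      measurable-⋃ : ∀ (A : ℕ → Pred Ω 0ℓ) → (∀ n → Measurable (A n)) → Measurable (⋃ ℕ A)

  record ProbabilityMeasure (M : MeasurableSpace) : Set₁ where
    open MeasurableSpace M
    field
      ℙ          : Pred Ω 0ℓ → ℝ
      ℙ-cong     : ∀ {A B} → A ≐ B → Measurable A → ℙ A ≈ ℙ B
      ℙ-nonNeg   : ∀ {A} → Measurable A → 0# ≤ ℙ A
      ℙ-U        : ℙ U ≈ 1#
      ℙ-additive : (A : ℕ → Pred Ω 0ℓ) → (∀ n → Measurable (A n)) →
                   (∀ m n → m ≢ n → ∀ ω → ¬ (A m ∩ A n) ω) →
                   HasSeries (ℙ ∘ A) (ℙ (⋃ ℕ A))

    infix 5 _∣_

    _∣_ : Pred Ω 0ℓ → Pred Ω 0ℓ → ℝ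
    A ∣ B = ℙ (A ∩ B) / ℙ B

    -- The Lebesgue integral of Y : Ω → [0,∞], i.e. the supremum of the
    -- integrals of the nonnegative measurable simple functions below Y; it is
    -- ∞ when these are unbounded.  A simple function Σ c 1_A is the list of
    -- its pairs (c , A).

    Simple : Set₁
    Simple = List (ℝ ∧ Pred Ω 0ℓ)

    value : Simple → Ω → ℝ
    value s ω = foldr (λ (c , A) r → c * 𝟙 A ω + r) 0# s

    integral : Simple → ℝ
    integral s = foldr (λ (c , A) r → c * ℙ A + r) 0# s

    LowerSum : (Ω → ℝ ⁺) → Pred ℝ (lsuc 0ℓ)
    LowerSum Y r = Σ Simple λ s →
      All (λ (c , A) → (0# ≤ c) ∧ Measurable A) s ∧
      (∀ ω → [ value s ω ] ≤⁺ Y ω) ∧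
      (r ≈ integral s)

    𝔼⁺ : (Ω → ℝ ⁺) → ℝ ⁺
    𝔼⁺ Y with em {∃ (IsSupremum (LowerSum Y))}
    ... | yes (e , _) = [ e ]
    ... | no _        = ⊤⁺

    -- Meant for nonnegative Y.

    𝔼 : (Ω → ℝ) → ℝ
    𝔼 Y with 𝔼⁺ ([_] ∘ Y)
    ... | [ e ] = e
    ... | ⊤⁺    = 0#

  ----------------------------------------------------------------------
  -- Transition matrices

  module _ {S : Set} where

    record IsTransitionMatrix (P : S → S → ℝ) : Set where
      field
        nonNeg : ∀ j l → 0# ≤ P j l
        row    : ∀ j → HasSum (P j) 1#

    power : (S → S → ℝ) → ℕ → S → S → ℝ
    power P zero    j l = 𝟙 (_≡ l) j
    power P (suc t) j l = ∑ λ m → power P t j m * P m l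

    Irreducible : (S → S → ℝ) → Set
    Irreducible P = ∀ j l → ∃ λ t → 0# < power P t j l

    record IsStationary (P : S → S → ℝ) (π : S → ℝ) : Set where
      field
        nonNeg     : ∀ j → 0# ≤ π j
        total      : HasSum π 1#
        stationary : ∀ l → HasSum (λ j → π j * P j l) (π l)

    fundamentalTerm : (S → S → ℝ) → (S → ℝ) → S → S → ℕ → ℝ
    fundamentalTerm P π j l t = power P t j l - π l

    fundamental : (S → S → ℝ) → (S → ℝ) → S → S → ℝ
    fundamental P π j l = series (fundamentalTerm P π j l)

  ----------------------------------------------------------------------
  -- Markov chains

  -- A chain is a process together with the laws ℙ[ i ] = ℙ( · | X₀ = i ).

  record MarkovChain {S : Set} (P : S → S → ℝ) : Set₁ where
    field
      space : MeasurableSpace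

    open MeasurableSpace space public

    field
      X            : ℕ → Ω → S
      X-measurable : ∀ t x → Measurable (λ ω → X t ω ≡ x)
      law          : S → ProbabilityMeasure space

    module Law (i : S) = ProbabilityMeasure (law i)

    ℙ[_] : S → Pred Ω 0ℓ → ℝ
    ℙ[ i ] = Law.ℙ i

    History : (ℕ → S) → ℕ → Pred Ω 0ℓ
    History x t ω = ∀ s → s ℕ.≤ t → X s ω ≡ x s

    field
      start  : ∀ i → ℙ[ i ] (λ ω → X 0 ω ≡ i) ≈ 1#
      markov : ∀ i (x : ℕ → S) t y → ¬ (ℙ[ i ] (History x t) ≈ 0#) →
               Law._∣_ i (λ ω → X (suc t) ω ≡ y) (History x t) ≈ P (x t) y

    IsReturnTime : S → Ω → Pred ℕ 0ℓ
    IsReturnTime i ω n = (1 ℕ.≤ n) ∧ (X n ω ≡ i) ∧ (∀ m → 1 ℕ.≤ m → m ℕ.< n → X m ω ≢ i)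

    T : S → Ω → ℕ ⁺
    T i ω with decide (∃ (IsReturnTime i ω))
    ... | yes (n , _) = [ n ]
    ... | no _        = ⊤⁺

    T[_]>_ : S → ℕ → Pred Ω 0ℓ
    (T[ i ]> θ) ω = [ θ ] <∞ T i ω

    fromℕ⁺ : ℕ ⁺ → ℝ ⁺
    fromℕ⁺ [ n ] = [ fromℕ n ]
    fromℕ⁺ ⊤⁺    = ⊤⁺

    PositiveRecurrent : Set
    PositiveRecurrent = ∀ i → Law.𝔼⁺ i (fromℕ⁺ ∘ T i) <⁺ ⊤⁺

    min : ℕ ⁺ → ℕ → ℕ
    min [ n ] θ = n ℕ.⊓ θ
    min ⊤⁺    θ = θ

    Γ-term : (π : S → ℝ) → S → ℕ → S → ℝ
    Γ-term π i θ q =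
      𝟙 (_≢ i) q *
      (Law._∣_ i (λ ω → X θ ω ≡ q) (T[ i ]> θ) * (fundamental P π i i - fundamental P π q i))

    Γ : (π : S → ℝ) → S → ℕ → ℝ
    Γ π i θ = ∑ (Γ-term π i θ)

    -- N independent copies of min(T_i , θ), where the chain is started at i.
    -- They live on a probability space of their own.

    record Samples (i : S) (θ N : ℕ) : Set₁ where
      field
        sampleSpace  : MeasurableSpace
        sampleLaw    : ProbabilityMeasure sampleSpace

      open MeasurableSpace sampleSpace using () renaming (Ω to Ω′; Measurable to Measurable′)
      open ProbabilityMeasure sampleLaw using () renaming (ℙ to ℙ′; 𝔼 to 𝔼′)

      field
        Y            : Fin N → Ω′ → ℕ
        Y-measurable : ∀ j n → Measurable′ (λ ω → Y j ω ≡ n)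
        distribution : ∀ j (B : Pred ℕ 0ℓ) →
                       ℙ′ (λ ω → B (Y j ω)) ≈ ℙ[ i ] (λ ω → B (min (T i ω) θ))
        independent  : ∀ (B : Fin N → Pred ℕ 0ℓ) →
                       ℙ′ (⋂ (Fin N) λ j ω → B j (Y j ω)) ≈ product λ j → ℙ′ (λ ω → B j (Y j ω))

      T̂ : Ω′ → ℝ
      T̂ ω = sum (λ j → fromℕ (Y j ω)) / fromℕ N

      𝔼[T̂] : ℝ
      𝔼[T̂] = 𝔼′ T̂

  θ⟨_⟩ : ℕ → ℕ
  θ⟨ k ⟩ = 2 ℕ.^ k

{-# OPTIONS --safe #-}

-- Let a_t(q) = ℙ_i(X_t = q, T_i > t) and p_t = Σ_q a_t(q) = ℙ_i(T_i > t), so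
-- that 𝔼_i[min(T_i, θ)] = Σ_{t<θ} p_t.  With h(q) = Z_ii - Z_qi the claim reads
-- Σ_q a_θ(q) h(q) = 1 - π_i Σ_{t<θ} p_t.  Here h is the limit of
-- h_n(q) = Σ_{t<n} (P^t_ii - P^t_qi), and conditioning on the first step gives
--   Σ_q a_{t+1}(q) h_n(q) = Σ_q a_t(q) h_n(q) + a_t(i) - Σ_q a_t(q) P^n_qi.
-- Summing over t < θ and letting n → ∞ yields the claim.  The limit may be
-- taken inside the sum because 0 ≤ h_n(q) ≤ 𝔼_q[min(T_i, n)], and positive
-- recurrence bounds Σ_q a_θ(q) 𝔼_q[T_i] = Σ_{t≥θ} p_t.

module Submission where

-- Sums over the state space are unconditional limits, and they can be interchanged and compared
-- freely only for nonnegative families; so every identity is arranged between such families, and a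
-- difference is formed only termwise below a larger family. This makes the sign of h_n essential.
-- Off i the first step gives h_{n+1}(q) = Σ_m P_qm h_n(m) + P^n_ii, and h_n(i) = 0, so h_n ≥ 0 by
-- induction. The same recursion with 1 in place of P^n_ii defines the truncated expected hitting
-- time, so the upper bound on h_n is also an induction on n. The number π_i arises as a limit:
-- convergence of the series for Z_qi forces its terms to vanish, hence P^n_qi → π_i, and by
-- dominated convergence Σ_q a_t(q) P^n_qi → π_i p_t. With E = Σ_{t<θ} p_t the result is used in the
-- form p_θ Γ = 1 - π_i E, which remains meaningful when p_θ = 0 and the conditional probabilities
-- in Γ take their default value. Subtracting p_θ and dividing by E, which is at least p_0 = 1,
-- gives the theorem.

open import Defs
open import Algebra.Bundles using (CommutativeRing; RawRing)
import Algebra.Properties.Monoid.Sum as MonoidSum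
open import Algebra.Solver.Ring.AlmostCommutativeRing using (fromCommutativeRing; _-Raw-AlmostCommutative⟶_)
open import Axiom.ExcludedMiddle using (ExcludedMiddle)
open import Data.Empty using (⊥-elim)
open import Data.Fin.Base as Fin using (Fin; toℕ)
open import Data.List.Base using (List; []; _∷_; _++_; deduplicate)
open import Data.List.Membership.Propositional using (_∈_)
open import Data.List.Membership.Propositional.Properties using (∈-∃++; ∈-++⁺ˡ; ∈-++⁺ʳ; ∈-++⁻; ∈-deduplicate⁺)
open import Data.List.Relation.Binary.Subset.Propositional using () renaming (_⊆_ to _⊆ˡ_)
open import Data.List.Relation.Unary.All as All using (All; []; _∷_)
open import Data.List.Relation.Unary.AllPairs using ([]; _∷_)
open import Data.List.Relation.Unary.Any using (here; there)
open import Data.List.Relation.Unary.Unique.DecPropositional.Properties using (deduplicate-!)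
open import Data.List.Relation.Unary.Unique.Propositional using (Unique)
open import Data.Maybe.Base using (Maybe; just; nothing)
open import Data.Nat.Base as ℕ using (ℕ; zero; suc)
import Data.Nat.Properties as ℕₚ
open import Data.Product.Base using (∃; _,_; proj₁; proj₂) renaming (_×_ to _∧_)
open import Data.Sum.Base using (_⊎_; inj₁; inj₂; [_,_]′)
open import Function.Base using (_∘_)
open import Function.Bundles using (Injection)
open import Level using (0ℓ; Lift; lift; lower) renaming (suc to lsuc)
import Relation.Binary.Construct.Add.Supremum.NonStrict as SupremumNonStrict
import Relation.Binary.Construct.Add.Supremum.Strict as SupremumStrict
import Relation.Binary.Construct.NonStrictToStrict as NonStrictToStrict
open import Relation.Binary.PropositionalEquality.Core as ≡ using (_≡_; _≢_)
open import Relation.Binary.Structures using (IsTotalOrder)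
open import Relation.Nullary.Construct.Add.Supremum using ([_]; ⊤⁺)
open import Relation.Nullary.Decidable.Core using (Dec; yes; no; decidable-stable)
open import Relation.Nullary.Negation.Core using (¬_; contradiction)
open import Relation.Unary using (Pred; U; ∁; ⋃; ⋂; _∩_; _∪_; _≐_; ∅)
open import Relation.Unary.Properties using (≐-sym)

-- A ring solver with integer coefficients.  The integer a - b is represented
-- by the pair (a , b); evaluation cancels, so that equal integers evaluate to
-- the same term.

module IntegerSolver (𝓡 : CommutativeRing 0ℓ 0ℓ) where

  open CommutativeRing 𝓡
  open import Algebra.Properties.Ring ring
  open import Algebra.Properties.AbelianGroup +-abelianGroup using (⁻¹-∙-comm)
  open import Algebra.Properties.CommutativeSemigroup +-commutativeSemigroup using (interchange)
  open import Algebra.Properties.Group +-group using (ε⁻¹≈ε; ⁻¹-involutive)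
  open import Algebra.Properties.Semiring.Mult.TCOptimised semiring
  open import Relation.Binary.Reasoning.Setoid setoid

  sub-interchange : ∀ a b c d → (a + c) - (b + d) ≈ (a - b) + (c - d)
  sub-interchange a b c d = trans (+-congˡ (sym (⁻¹-∙-comm b d))) (interchange a c (- b) (- d))

  Coeff : Set
  Coeff = ℕ ∧ ℕ

  ι : ℕ → Carrier
  ι n = n × 1#

  eval : Coeff → Carrier
  eval (a     , zero)  = ι a
  eval (zero  , suc b) = - ι (suc b)
  eval (suc a , suc b) = eval (a , b)

  eval-≈ : ∀ a b → eval (a , b) ≈ ι a - ι b
  eval-≈ a       zero    = sym (trans (+-congˡ ε⁻¹≈ε) (+-identityʳ _))
  eval-≈ zero    (suc b) = sym (+-identityˡ _)
  eval-≈ (suc a) (suc b) = begin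
    eval (a , b)                  ≈⟨ eval-≈ a b ⟩
    ι a - ι b                     ≈⟨ +-identityˡ _ ⟨
    0# + (ι a - ι b)              ≈⟨ +-congʳ (-‿inverseʳ 1#) ⟨
    (1# - 1#) + (ι a - ι b)       ≈⟨ sub-interchange _ _ _ _ ⟨
    (1# + ι a) - (1# + ι b)       ≈⟨ +-cong (1+× a 1#) (-‿cong (1+× b 1#)) ⟨
    ι (suc a) - ι (suc b)         ∎

  coeffRing : RawRing 0ℓ 0ℓ
  coeffRing = record
    { Carrier = Coeff
    ; _≈_     = _≡_
    ; _+_     = λ (a , b) (c , d) → a ℕ.+ c , b ℕ.+ d
    ; _*_     = λ (a , b) (c , d) → a ℕ.* c ℕ.+ b ℕ.* d , a ℕ.* d ℕ.+ b ℕ.* c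
    ; -_      = λ (a , b) → b , a
    ; 0#      = 0 , 0
    ; 1#      = 1 , 0
    }

  eval-+ : ∀ x y → eval (RawRing._+_ coeffRing x y) ≈ eval x + eval y
  eval-+ (a , b) (c , d) = begin
    eval (a ℕ.+ c , b ℕ.+ d)      ≈⟨ eval-≈ (a ℕ.+ c) (b ℕ.+ d) ⟩
    ι (a ℕ.+ c) - ι (b ℕ.+ d)     ≈⟨ +-cong (×-homo-+ 1# a c) (-‿cong (×-homo-+ 1# b d)) ⟩
    (ι a + ι c) - (ι b + ι d)     ≈⟨ sub-interchange _ _ _ _ ⟩
    (ι a - ι b) + (ι c - ι d)     ≈⟨ +-cong (eval-≈ a b) (eval-≈ c d) ⟨
    eval (a , b) + eval (c , d)   ∎

  eval-* : ∀ x y → eval (RawRing._*_ coeffRing x y) ≈ eval x * eval y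
  eval-* (a , b) (c , d) = begin
    eval (a ℕ.* c ℕ.+ b ℕ.* d , a ℕ.* d ℕ.+ b ℕ.* c)
      ≈⟨ eval-≈ (a ℕ.* c ℕ.+ b ℕ.* d) (a ℕ.* d ℕ.+ b ℕ.* c) ⟩
    ι (a ℕ.* c ℕ.+ b ℕ.* d) - ι (a ℕ.* d ℕ.+ b ℕ.* c)
      ≈⟨ +-cong (ι-*+* a c b d) (-‿cong (ι-*+* a d b c)) ⟩
    (ι a * ι c + ι b * ι d) - (ι a * ι d + ι b * ι c)
      ≈⟨ sub-interchange _ _ _ _ ⟩
    (ι a * ι c - ι a * ι d) + (ι b * ι d - ι b * ι c)
      ≈⟨ +-cong (x[y-z]≈xy-xz _ _ _) (x[y-z]≈xy-xz _ _ _) ⟨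
    ι a * (ι c - ι d) + ι b * (ι d - ι c)
      ≈⟨ +-congˡ (*-congˡ flip-sub) ⟩
    ι a * (ι c - ι d) + ι b * - (ι c - ι d)
      ≈⟨ +-congˡ (trans (sym (-‿distribʳ-* _ _)) (-‿distribˡ-* _ _)) ⟩
    ι a * (ι c - ι d) + (- ι b) * (ι c - ι d)
      ≈⟨ distribʳ _ _ _ ⟨
    (ι a - ι b) * (ι c - ι d)
      ≈⟨ *-cong (eval-≈ a b) (eval-≈ c d) ⟨
    eval (a , b) * eval (c , d) ∎
    where
    ι-*+* : ∀ m n k l → ι (m ℕ.* n ℕ.+ k ℕ.* l) ≈ ι m * ι n + ι k * ι l
    ι-*+* m n k l = trans (×-homo-+ 1# (m ℕ.* n) (k ℕ.* l)) (+-cong (×1-homo-* m n) (×1-homo-* k l))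
    flip-sub : ι d - ι c ≈ - (ι c - ι d)
    flip-sub = trans (+-comm _ _) (trans (+-congˡ (sym (⁻¹-involutive _))) (⁻¹-∙-comm _ _))

  eval-neg : ∀ x → eval (RawRing.-_ coeffRing x) ≈ - eval x
  eval-neg (a , b) = begin
    eval (b , a)    ≈⟨ eval-≈ b a ⟩
    ι b - ι a       ≈⟨ +-comm _ _ ⟩
    - ι a + ι b     ≈⟨ +-congˡ (⁻¹-involutive _) ⟨
    - ι a - (- ι b) ≈⟨ ⁻¹-∙-comm _ _ ⟩
    - (ι a - ι b)   ≈⟨ -‿cong (eval-≈ a b) ⟨
    - eval (a , b)  ∎

  morphism : coeffRing -Raw-AlmostCommutative⟶ fromCommutativeRing 𝓡
  morphism = record
    { ⟦_⟧    = eval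
    ; +-homo = eval-+
    ; *-homo = eval-*
    ; -‿homo = eval-neg
    ; 0-homo = refl
    ; 1-homo = refl
    }

  eval-cong : ∀ a b c d → a ℕ.+ d ≡ c ℕ.+ b → eval (a , b) ≈ eval (c , d)
  eval-cong a b c d eq = begin
    eval (a , b)                ≈⟨ eval-≈ a b ⟩
    ι a - ι b                   ≈⟨ cancel (ι a) (ι b) (ι d) ⟨
    (ι a + ι d) - (ι b + ι d)   ≈⟨ +-cong (×-homo-+ 1# a d) refl ⟨
    ι (a ℕ.+ d) - (ι b + ι d)   ≡⟨ ≡.cong (λ n → ι n - (ι b + ι d)) eq ⟩
    ι (c ℕ.+ b) - (ι b + ι d)   ≈⟨ +-cong (×-homo-+ 1# c b) (-‿cong (+-comm _ _)) ⟩
    (ι c + ι b) - (ι d + ι b)   ≈⟨ cancel (ι c) (ι d) (ι b) ⟩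
    ι c - ι d                   ≈⟨ eval-≈ c d ⟨
    eval (c , d)                ∎
    where
    cancel : ∀ x y z → (x + z) - (y + z) ≈ x - y
    cancel x y z = trans (sub-interchange x y z z) (trans (+-congˡ (-‿inverseʳ z)) (+-identityʳ _))

  -- The solver may identify coefficients as soon as their values in the ring agree. The test
  -- `a + d ≡ c + b` says that the two pairs represent the same integer, so it is valid in every
  -- commutative ring.
  eval≟ : ∀ x y → Maybe (eval x ≈ eval y)
  eval≟ (a , b) (c , d) with a ℕ.+ d ℕₚ.≟ c ℕ.+ b
  ... | yes eq = just (eval-cong a b c d eq)
  ... | no _   = nothing

  open import Algebra.Solver.Ring coeffRing (fromCommutativeRing 𝓡) morphism eval≟ public
    using (Polynomial; solve; _:=_; _:+_; _:*_; _:-_; :-_; con)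

  :0 : ∀ {n} → Polynomial n
  :0 = con (0 , 0)

  :1 : ∀ {n} → Polynomial n
  :1 = con (1 , 0)

-- Inequalities and limits in a complete ordered field

module OrderedField (em : ExcludedMiddle (lsuc 0ℓ)) (R : CompleteOrderedField) where

  open CompleteOrderedField R
  open Theory em R
  open IntegerSolver commutativeRing
  open IsTotalOrder isTotalOrder public
    using (antisym; total; ≤-resp-≈)
    renaming (refl to ≤-refl; trans to ≤-trans; reflexive to ≤-reflexive)

  +-monoʳ-≤ : ∀ z {x y} → x ≤ y → z + x ≤ z + y
  +-monoʳ-≤ z x≤y = ≤-trans (≤-reflexive (+-comm _ _)) (≤-trans (+-monoˡ-≤ z x≤y) (≤-reflexive (+-comm _ _)))

  +-mono-≤ : ∀ {x y u v} → x ≤ y → u ≤ v → x + u ≤ y + v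
  +-mono-≤ x≤y u≤v = ≤-trans (+-monoˡ-≤ _ x≤y) (+-monoʳ-≤ _ u≤v)

  ≤⇒0≤- : ∀ {x y} → x ≤ y → 0# ≤ y - x
  ≤⇒0≤- x≤y = ≤-trans (≤-reflexive (sym (-‿inverseʳ _))) (+-monoˡ-≤ _ x≤y)

  0≤-⇒≤ : ∀ {x y} → 0# ≤ y - x → x ≤ y
  0≤-⇒≤ {x} {y} 0≤ = ≤-trans (≤-reflexive (sym (+-identityˡ x)))
    (≤-trans (+-monoˡ-≤ x 0≤) (≤-reflexive (solve 2 (λ x y → (y :- x) :+ x := y) refl x y)))

  +-nonNeg : ∀ {x y} → 0# ≤ x → 0# ≤ y → 0# ≤ x + y
  +-nonNeg 0≤x 0≤y = ≤-trans (≤-reflexive (sym (+-identityˡ 0#))) (+-mono-≤ 0≤x 0≤y)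

  -- Linear inequalities are certified by writing the difference of the two
  -- sides as a sum of differences that are known to be nonnegative.

  linear₁ : ∀ {x y a b} → a ≤ b → y - x ≈ b - a → x ≤ y
  linear₁ a≤b eq = 0≤-⇒≤ (≤-trans (≤⇒0≤- a≤b) (≤-reflexive (sym eq)))

  linear₂ : ∀ {x y a b c d} → a ≤ b → c ≤ d → y - x ≈ (b - a) + (d - c) → x ≤ y
  linear₂ a≤b c≤d eq = 0≤-⇒≤ (≤-trans (+-nonNeg (≤⇒0≤- a≤b) (≤⇒0≤- c≤d)) (≤-reflexive (sym eq)))

  linear₃ : ∀ {x y a b c d e f} → a ≤ b → c ≤ d → e ≤ f → y - x ≈ (b - a) + (d - c) + (f - e) → x ≤ y
  linear₃ a≤b c≤d e≤f eq =
    0≤-⇒≤ (≤-trans (+-nonNeg (+-nonNeg (≤⇒0≤- a≤b) (≤⇒0≤- c≤d)) (≤⇒0≤- e≤f)) (≤-reflexive (sym eq)))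

  *-monoʳ-≤ : ∀ {c x y} → 0# ≤ c → x ≤ y → c * x ≤ c * y
  *-monoʳ-≤ {c} {x} {y} 0≤c x≤y = 0≤-⇒≤ (≤-trans (*-nonNeg 0≤c (≤⇒0≤- x≤y))
    (≤-reflexive (solve 3 (λ c x y → c :* (y :- x) := c :* y :- c :* x) refl c x y)))

  *-monoˡ-≤ : ∀ {c x y} → 0# ≤ c → x ≤ y → x * c ≤ y * c
  *-monoˡ-≤ 0≤c x≤y = ≤-trans (≤-reflexive (*-comm _ _)) (≤-trans (*-monoʳ-≤ 0≤c x≤y) (≤-reflexive (*-comm _ _)))

  -- If 1 ≤ 0, then -1 is nonnegative, and 1 is its square.
  0≤1 : 0# ≤ 1#
  0≤1 with total 0# 1#
  ... | inj₁ 0≤1 = 0≤1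
  ... | inj₂ 1≤0 = ≤-trans (*-nonNeg 0≤-1 0≤-1) (≤-reflexive (solve 0 ((:0 :- :1) :* (:0 :- :1) := :1) refl))
    where
    0≤-1 : 0# ≤ 0# - 1#
    0≤-1 = ≤⇒0≤- 1≤0

  -- At 0 this is the convention 0⁻¹ = 0. Otherwise a nonpositive inverse would give 1 = x x⁻¹ ≤ 0.
  ⁻¹-nonNeg : ∀ {x} → 0# ≤ x → 0# ≤ x ⁻¹
  ⁻¹-nonNeg {x} 0≤x with decide (x ≈ 0#) | total 0# (x ⁻¹)
  ... | yes x≈0 | _           = ≤-reflexive (sym (trans (⁻¹-cong x≈0) 0⁻¹≈0))
  ... | no _    | inj₁ 0≤x⁻¹  = 0≤x⁻¹
  ... | no x≉0  | inj₂ x⁻¹≤0  = contradiction (antisym 1≤0 0≤1) 1≉0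
    where
    1≤0 : 1# ≤ 0#
    1≤0 = ≤-trans (≤-reflexive (sym (⁻¹-inverse x x≉0)))
      (≤-trans (*-monoʳ-≤ 0≤x x⁻¹≤0) (≤-reflexive (zeroʳ x)))

  positive : ∀ {x y} → 0# ≤ x → x + 1# ≤ y → 0# < y
  positive {x} {y} 0≤x x+1≤y = ≤-trans (≤-trans 0≤x (linear₁ 0≤1 (solve 1 (λ x → x :+ :1 :- x := :1 :- :0) refl x))) x+1≤y
    , λ 0≈y → 1≉0 (antisym (linear₃ 0≤x x+1≤y (≤-reflexive (sym 0≈y))
        (solve 2 (λ x y → :0 :- :1 := (x :- :0) :+ (y :- (x :+ :1)) :+ (:0 :- y)) refl x y)) 0≤1)

  2ᵣ : ℝ
  2ᵣ = 1# + 1#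

  2≉0 : ¬ (2ᵣ ≈ 0#)
  2≉0 = proj₂ (positive 0≤1 ≤-refl) ∘ sym

  half : ℝ → ℝ
  half ε = 2ᵣ ⁻¹ * ε

  half+half : ∀ ε → half ε + half ε ≈ ε
  half+half ε = trans (solve 2 (λ h ε → h :* ε :+ h :* ε := ((:1 :+ :1) :* h) :* ε) refl (2ᵣ ⁻¹) ε)
    (trans (*-congʳ (⁻¹-inverse 2ᵣ 2≉0)) (*-identityˡ ε))

  half-pos : ∀ {ε} → 0# < ε → 0# < half ε
  half-pos {ε} (0≤ε , 0≉ε) = *-nonNeg (⁻¹-nonNeg (+-nonNeg 0≤1 0≤1)) 0≤ε
    , λ 0≈h → 0≉ε (trans (trans (sym (+-identityˡ 0#)) (+-cong 0≈h 0≈h)) (half+half ε))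

  ≰⇒> : ∀ {x y} → ¬ (x ≤ y) → y < x
  ≰⇒> = NonStrictToStrict.≰⇒> _≈_ _≤_ sym ≤-reflexive total

  ≤-by-contra : ∀ {x y} → (y < x → x ≤ y) → x ≤ y
  ≤-by-contra {x} {y} f with decide (x ≤ y)
  ... | yes x≤y = x≤y
  ... | no x≰y  = f (≰⇒> x≰y)

  diff-pos : ∀ {x y} → y < x → 0# < x - y
  diff-pos {x} {y} (y≤x , y≉x) = ≤⇒0≤- y≤x , λ 0≈ → y≉x
    (trans (sym (+-identityˡ y)) (trans (+-congʳ 0≈) (solve 2 (λ x y → x :- y :+ y := x) refl x y)))

  ≤-ε : ∀ {x y} → (∀ ε → 0# < ε → x ≤ y + ε) → x ≤ y
  ≤-ε {x} {y} f = ≤-by-contra λ y<x →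
    let δ   = half (x - y)
        eq  = half+half (x - y)
        x≤′ = f δ (half-pos (diff-pos y<x))
    -- Adding x ≤ y + δ to itself, with 2δ = x - y, gives 2x ≤ x + y.
    in linear₃ x≤′ x≤′ (≤-reflexive eq)
         (solve 3 (λ x y δ → y :- x := (y :+ δ :- x) :+ (y :+ δ :- x) :+ (x :- y :- (δ :+ δ))) refl x y δ)

  <-shrink : ∀ {x ε} → 0# < ε → (x - ε < x) ∧ (x < x + ε)
  <-shrink {x} {ε} (0≤ε , 0≉ε) =
    (linear₁ 0≤ε (solve 2 (λ x ε → x :- (x :- ε) := ε :- :0) refl x ε) ,
      λ eq → 0≉ε (trans (sym (-‿inverseʳ x)) (trans (+-congˡ (-‿cong (sym eq))) (solve 2 (λ x ε → x :- (x :- ε) := ε) refl x ε)))) ,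
    (linear₁ 0≤ε (solve 2 (λ x ε → x :+ ε :- x := ε :- :0) refl x ε) ,
      λ eq → 0≉ε (trans (sym (-‿inverseʳ x)) (trans (+-congʳ eq) (solve 2 (λ x ε → x :+ ε :- x := ε) refl x ε))))

  ≤-<-trans : ∀ {x y z} → x ≤ y → y < z → x < z
  ≤-<-trans = NonStrictToStrict.≤-<-trans _≈_ _≤_ ≤-trans antisym (proj₂ ≤-resp-≈)

  <-≤-trans : ∀ {x y z} → x < y → y ≤ z → x < z
  <-≤-trans = NonStrictToStrict.<-≤-trans _≈_ _≤_ sym ≤-trans antisym (proj₁ ≤-resp-≈)

  fromℕ-nonNeg : ∀ n → 0# ≤ fromℕ n
  fromℕ-nonNeg zero    = ≤-refl
  fromℕ-nonNeg (suc n) = +-nonNeg 0≤1 (fromℕ-nonNeg n)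

  fromℕ-suc≉0 : ∀ n → ¬ (fromℕ (suc n) ≈ 0#)
  fromℕ-suc≉0 n = proj₂ (positive (fromℕ-nonNeg n) (≤-reflexive (+-comm (fromℕ n) 1#))) ∘ sym

  fromℕ-mono-≤ : ∀ {m n} → m ℕ.≤ n → fromℕ m ≤ fromℕ n
  fromℕ-mono-≤ {n = n} ℕ.z≤n = fromℕ-nonNeg n
  fromℕ-mono-≤ (ℕ.s≤s l) = +-monoʳ-≤ 1# (fromℕ-mono-≤ l)

  𝟙-yes : ∀ {I : Set} (A : Pred I 0ℓ) {x} → A x → 𝟙 A x ≈ 1#
  𝟙-yes A {x} a with em {Lift (lsuc 0ℓ) (A x)}
  ... | yes _ = refl
  ... | no ¬a = contradiction (lift a) ¬a

  𝟙-no : ∀ {I : Set} (A : Pred I 0ℓ) {x} → ¬ A x → 𝟙 A x ≈ 0#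
  𝟙-no A {x} ¬a with em {Lift (lsuc 0ℓ) (A x)}
  ... | yes a = contradiction (lower a) ¬a
  ... | no _  = refl

  𝟙-nonNeg : ∀ {I : Set} (A : Pred I 0ℓ) x → 0# ≤ 𝟙 A x
  𝟙-nonNeg A x with em {Lift (lsuc 0ℓ) (A x)}
  ... | yes _ = 0≤1
  ... | no _  = ≤-refl

  -- Limits

  -- The weak inequalities are equivalent to the strict ones of _⟶_ but easier
  -- to combine.

  Lim : (ℕ → ℝ) → ℝ → Set
  Lim s l = ∀ ε → 0# < ε → ∃ λ N → ∀ n → N ℕ.≤ n → (l - ε ≤ s n) ∧ (s n ≤ l + ε)

  ⟶⇒Lim : ∀ {s l} → s ⟶ l → Lim s l
  ⟶⇒Lim s⟶l ε 0<ε = let N , near = s⟶l ε 0<ε in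
    N , λ n N≤n → proj₁ (proj₁ (near n N≤n)) , proj₁ (proj₂ (near n N≤n))

  Lim-const : ∀ x → Lim (λ _ → x) x
  Lim-const x ε 0<ε = 0 , λ _ _ → proj₁ (proj₁ (<-shrink 0<ε)) , proj₁ (proj₂ (<-shrink 0<ε))

  Lim-cong : ∀ {s t l m} → (∀ n → s n ≈ t n) → l ≈ m → Lim s l → Lim t m
  Lim-cong s≈t l≈m lim ε 0<ε = let N , near = lim ε 0<ε in
    N , λ n N≤n → ≤-trans (≤-reflexive (+-congʳ (sym l≈m))) (≤-trans (proj₁ (near n N≤n)) (≤-reflexive (s≈t n)))
      , ≤-trans (≤-reflexive (sym (s≈t n))) (≤-trans (proj₂ (near n N≤n)) (≤-reflexive (+-congʳ l≈m)))

  Lim-suc : ∀ {s l} → Lim s l → Lim (s ∘ suc) l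
  Lim-suc lim ε 0<ε = let N , near = lim ε 0<ε in N , λ n N≤n → near (suc n) (ℕₚ.m≤n⇒m≤1+n N≤n)

  Lim-+ : ∀ {s t l m} → Lim s l → Lim t m → Lim (λ n → s n + t n) (l + m)
  Lim-+ {s} {t} {l} {m} lims limt ε 0<ε =
    let δ = half ε
        M , nears = lims δ (half-pos 0<ε)
        N , neart = limt δ (half-pos 0<ε)
        δδ = half+half ε
    in M ℕ.⊔ N , λ n MN≤n →
      let s₁ , s₂ = nears n (ℕₚ.≤-trans (ℕₚ.m≤m⊔n M N) MN≤n)
          t₁ , t₂ = neart n (ℕₚ.≤-trans (ℕₚ.m≤n⊔m M N) MN≤n)
      in linear₃ s₁ t₁ (≤-reflexive δδ) (solve 6 (λ s t l m δ ε →
           s :+ t :- (l :+ m :- ε) := (s :- (l :- δ)) :+ (t :- (m :- δ)) :+ (ε :- (δ :+ δ))) refl (s n) (t n) l m δ ε)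
       , linear₃ s₂ t₂ (≤-reflexive δδ) (solve 6 (λ s t l m δ ε →
           l :+ m :+ ε :- (s :+ t) := (l :+ δ :- s) :+ (m :+ δ :- t) :+ (ε :- (δ :+ δ))) refl (s n) (t n) l m δ ε)

  Lim-neg : ∀ {s l} → Lim s l → Lim (λ n → - s n) (- l)
  Lim-neg {s} {l} lim ε 0<ε = let N , near = lim ε 0<ε in N , λ n N≤n →
    linear₁ (proj₂ (near n N≤n)) (solve 3 (λ s l ε → :- s :- (:- l :- ε) := l :+ ε :- s) refl (s n) l ε) ,
    linear₁ (proj₁ (near n N≤n)) (solve 3 (λ s l ε → :- l :+ ε :- (:- s) := s :- (l :- ε)) refl (s n) l ε)

  Lim-scale : ∀ {c s l} → 0# ≤ c → Lim s l → Lim (λ n → c * s n) (c * l)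
  Lim-scale {c} {s} {l} 0≤c lim ε 0<ε =
    let d    = c + 1#
        0<d  = positive 0≤c ≤-refl
        dd⁻¹ = ⁻¹-inverse d (proj₂ 0<d ∘ sym)
        δ    = ε * d ⁻¹
        dδ≈ε : d * δ ≈ ε
        dδ≈ε = trans (solve 3 (λ d ε i → d :* (ε :* i) := (d :* i) :* ε) refl d ε (d ⁻¹)) (trans (*-congʳ dd⁻¹) (*-identityˡ ε))
        0≤δ  = *-nonNeg (proj₁ 0<ε) (⁻¹-nonNeg (proj₁ 0<d))
        0<δ  = 0≤δ , λ 0≈δ → proj₂ 0<ε (trans (sym (zeroʳ d)) (trans (*-congˡ 0≈δ) dδ≈ε))
        N , near = lim δ 0<δ
    in N , λ n N≤n →
      linear₃ (*-monoʳ-≤ 0≤c (proj₁ (near n N≤n))) 0≤δ (≤-reflexive dδ≈ε) (solve 5 (λ c s l δ ε →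
        c :* s :- (c :* l :- ε) := (c :* s :- c :* (l :- δ)) :+ (δ :- :0) :+ (ε :- (c :+ :1) :* δ)) refl c (s n) l δ ε) ,
      linear₃ (*-monoʳ-≤ 0≤c (proj₂ (near n N≤n))) 0≤δ (≤-reflexive dδ≈ε) (solve 5 (λ c s l δ ε →
        c :* l :+ ε :- c :* s := (c :* (l :+ δ) :- c :* s) :+ (δ :- :0) :+ (ε :- (c :+ :1) :* δ)) refl c (s n) l δ ε)

  Lim-mono : ∀ {s t l m} → (∀ n → s n ≤ t n) → Lim s l → Lim t m → l ≤ m
  Lim-mono {s} {t} {l} {m} s≤t lims limt = ≤-ε λ ε 0<ε →
    let δ = half ε
        M , nears = lims δ (half-pos 0<ε)
        N , neart = limt δ (half-pos 0<ε)
        n = M ℕ.⊔ N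
        l-δ≤t = ≤-trans (proj₁ (nears n (ℕₚ.m≤m⊔n M N))) (s≤t n)
    in linear₃ l-δ≤t (proj₂ (neart n (ℕₚ.m≤n⊔m M N))) (≤-reflexive (half+half ε)) (solve 5 (λ t l m δ ε →
         m :+ ε :- l := (t :- (l :- δ)) :+ (m :+ δ :- t) :+ (ε :- (δ :+ δ))) refl (t n) l m δ ε)

  Lim-unique : ∀ {s l m} → Lim s l → Lim s m → l ≈ m
  Lim-unique limₗ limₘ = antisym (Lim-mono (λ _ → ≤-refl) limₗ limₘ) (Lim-mono (λ _ → ≤-refl) limₘ limₗ)

  Lim-≤ : ∀ {s l b} → (∀ n → s n ≤ b) → Lim s l → l ≤ b
  Lim-≤ s≤b lim = Lim-mono s≤b lim (Lim-const _)

  Lim-≥ : ∀ {s l b} → (∀ n → b ≤ s n) → Lim s l → b ≤ l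
  Lim-≥ b≤s lim = Lim-mono b≤s (Lim-const _) lim

  Monotone : (ℕ → ℝ) → Set
  Monotone s = ∀ n → s n ≤ s (suc n)

  monotone-≤ : ∀ {s} → Monotone s → ∀ {m n} → m ℕ.≤ n → s m ≤ s n
  monotone-≤ {s} mono m≤n = go (ℕₚ.≤⇒≤′ m≤n)
    where
    go : ∀ {m n} → m ℕ.≤′ n → s m ≤ s n
    go (ℕ.≤′-reflexive ≡.refl) = ≤-refl
    go (ℕ.≤′-step l)           = ≤-trans (go l) (mono _)

  monotone-convergence : ∀ {s b} → Monotone s → (∀ n → s n ≤ b) → ∃ λ l → Lim s l ∧ (∀ n → s n ≤ l)
  monotone-convergence {s} {b} mono s≤b =
    let l , upper , least = complete (λ x → ∃ λ n → x ≈ s n) (s 0 , 0 , refl)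
                              (b , λ x (n , x≈) → ≤-trans (≤-reflexive x≈) (s≤b n))
        s≤l : ∀ n → s n ≤ l
        s≤l n = upper (s n) (n , refl)
    in l , (λ ε 0<ε → lim l s≤l least ε 0<ε (decide (∃ λ N → l - ε ≤ s N))) , s≤l
    where
    lim : ∀ l → (∀ n → s n ≤ l) → (∀ b → IsUpperBound (λ x → ∃ λ n → x ≈ s n) b → l ≤ b) →
          ∀ ε → 0# < ε → Dec (∃ λ N → l - ε ≤ s N) →
          ∃ λ N → ∀ n → N ℕ.≤ n → (l - ε ≤ s n) ∧ (s n ≤ l + ε)
    lim l s≤l least ε 0<ε (yes (N , l-ε≤)) =
      N , λ n N≤n → ≤-trans l-ε≤ (monotone-≤ mono N≤n) , ≤-trans (s≤l n) (proj₁ (proj₂ (<-shrink 0<ε)))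
    lim l s≤l least ε 0<ε (no ∄) = ⊥-elim (proj₂ (proj₁ (<-shrink 0<ε))
      (antisym (proj₁ (proj₁ (<-shrink 0<ε))) (least (l - ε) λ x (n , x≈) →
        ≤-trans (≤-reflexive x≈) (proj₁ (≰⇒> λ l-ε≤ → ∄ (n , l-ε≤))))))

  -- Finite and infinite sums indexed by ℕ

  psum : ℕ → (ℕ → ℝ) → ℝ
  psum n f = sum {n} (f ∘ toℕ)

  psum-suc : ∀ n f → psum (suc n) f ≈ psum n f + f n
  psum-suc zero    f = +-comm _ _
  psum-suc (suc n) f = trans (+-congˡ (psum-suc n (f ∘ suc))) (sym (+-assoc _ _ _))

  psum-nonNeg : ∀ n {f} → (∀ k → 0# ≤ f k) → 0# ≤ psum n f
  psum-nonNeg zero    0≤f = ≤-refl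
  psum-nonNeg (suc n) 0≤f = +-nonNeg (0≤f 0) (psum-nonNeg n (0≤f ∘ suc))

  psum-cong : ∀ n {f g} → (∀ k → k ℕ.< n → f k ≈ g k) → psum n f ≈ psum n g
  psum-cong zero    f≈g = refl
  psum-cong (suc n) f≈g = +-cong (f≈g 0 (ℕ.s≤s ℕ.z≤n)) (psum-cong n λ k k<n → f≈g (suc k) (ℕ.s≤s k<n))

  psum-- : ∀ n f g → psum n (λ k → f k - g k) ≈ psum n f - psum n g
  psum-- zero    f g = solve 0 (:0 := :0 :- :0) refl
  psum-- (suc n) f g = trans (+-congˡ (psum-- n (f ∘ suc) (g ∘ suc)))
    (solve 4 (λ a b c d → (a :- b) :+ (c :- d) := (a :+ c) :- (b :+ d)) refl (f 0) (g 0) (psum n (f ∘ suc)) (psum n (g ∘ suc)))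

  psum-* : ∀ c n f → c * psum n f ≈ psum n (λ k → c * f k)
  psum-* c zero    f = zeroʳ c
  psum-* c (suc n) f = trans (distribˡ c _ _) (+-congˡ (psum-* c n (f ∘ suc)))

  psum-shift-≤ : ∀ {f} → (∀ k → 0# ≤ f k) → ∀ k n → psum n (λ s → f (s ℕ.+ k)) ≤ psum (n ℕ.+ k) f
  psum-shift-≤ {f} 0≤f zero    n = ≤-reflexive (trans (psum-cong n λ s _ → reflexive (≡.cong f (ℕₚ.+-identityʳ s)))
    (reflexive (≡.cong (λ m → psum m f) (≡.sym (ℕₚ.+-identityʳ n)))))
  psum-shift-≤ {f} 0≤f (suc k) n = ≤-trans
    (≤-reflexive (psum-cong n λ s _ → reflexive (≡.cong f (ℕₚ.+-suc s k))))
    -- Prepending the nonnegative term `f k` turns the window of length n that starts at `suc k`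
    -- into one of length `suc n` that starts at k.
    (≤-trans (linear₁ (0≤f k) (solve 2 (λ a b → a :+ b :- b := a :- :0) refl (f k) _))
      (≤-trans (psum-shift-≤ 0≤f k (suc n)) (≤-reflexive (reflexive (≡.cong (λ m → psum m f) (≡.sym (ℕₚ.+-suc n k)))))))

  Lim-psum : ∀ n {f : ℕ → ℕ → ℝ} {l} → (∀ k → Lim (f k) (l k)) → Lim (λ m → psum n (λ k → f k m)) (psum n l)
  Lim-psum zero    lim = Lim-const 0#
  Lim-psum (suc n) lim = Lim-+ (lim 0) (Lim-psum n (lim ∘ suc))

  HasSeries⇒Lim : ∀ {f s} → HasSeries f s → Lim (λ n → psum n f) s
  HasSeries⇒Lim = ⟶⇒Lim

  -- Each term is the difference of two consecutive partial sums, which have the same limit.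
  HasSeries⇒Lim0 : ∀ {f s} → HasSeries f s → Lim f 0#
  HasSeries⇒Lim0 {f} {s} hs = Lim-cong
    (λ n → trans (+-congʳ (psum-suc n f)) (solve 2 (λ p x → p :+ x :- p := x) refl (psum n f) (f n)))
    (-‿inverseʳ s)
    (Lim-+ (Lim-suc lim) (Lim-neg lim))
    where
    lim : Lim (λ n → psum n f) s
    lim = HasSeries⇒Lim {f} hs

  series-correct : ∀ {f} → Convergent f → HasSeries f (series f)
  series-correct {f} conv with decide (Convergent f)
  ... | yes (_ , hs) = hs
  ... | no ¬conv     = contradiction conv ¬conv

-- Unconditional sums of nonnegative families

module Sums (em : ExcludedMiddle (lsuc 0ℓ)) (R : CompleteOrderedField) where

  open CompleteOrderedField R
  open Theory em R
  open IntegerSolver commutativeRing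
  open OrderedField em R

  private variable
    I J : Set

  NonNeg : (I → ℝ) → Set
  NonNeg f = ∀ x → 0# ≤ f x

  sumOver-cong : ∀ xs {f g : I → ℝ} → (∀ x → f x ≈ g x) → sumOver xs f ≈ sumOver xs g
  sumOver-cong []       f≈g = refl
  sumOver-cong (x ∷ xs) f≈g = +-cong (f≈g x) (sumOver-cong xs f≈g)

  sumOver-mono : ∀ xs {f g : I → ℝ} → (∀ x → f x ≤ g x) → sumOver xs f ≤ sumOver xs g
  sumOver-mono []       f≤g = ≤-refl
  sumOver-mono (x ∷ xs) f≤g = +-mono-≤ (f≤g x) (sumOver-mono xs f≤g)

  sumOver-nonNeg : ∀ xs {f : I → ℝ} → NonNeg f → 0# ≤ sumOver xs f
  sumOver-nonNeg []       0≤f = ≤-refl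
  sumOver-nonNeg (x ∷ xs) 0≤f = +-nonNeg (0≤f x) (sumOver-nonNeg xs 0≤f)

  sumOver-0 : ∀ (xs : List I) → sumOver xs (λ _ → 0#) ≈ 0#
  sumOver-0 []       = refl
  sumOver-0 (x ∷ xs) = trans (+-identityˡ _) (sumOver-0 xs)

  sumOver-+ : ∀ xs (f g : I → ℝ) → sumOver xs (λ x → f x + g x) ≈ sumOver xs f + sumOver xs g
  sumOver-+ []       f g = sym (+-identityˡ 0#)
  sumOver-+ (x ∷ xs) f g = trans (+-congˡ (sumOver-+ xs f g))
    (solve 4 (λ a b c d → (a :+ b) :+ (c :+ d) := (a :+ c) :+ (b :+ d)) refl (f x) (g x) (sumOver xs f) (sumOver xs g))

  sumOver-neg : ∀ xs (f : I → ℝ) → sumOver xs (λ x → - f x) ≈ - sumOver xs f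
  sumOver-neg []       f = solve 0 (:0 := :- :0) refl
  sumOver-neg (x ∷ xs) f = trans (+-congˡ (sumOver-neg xs f))
    (solve 2 (λ a b → :- a :+ :- b := :- (a :+ b)) refl (f x) (sumOver xs f))

  sumOver-- : ∀ xs (f g : I → ℝ) → sumOver xs (λ x → f x - g x) ≈ sumOver xs f - sumOver xs g
  sumOver-- xs f g = trans (sumOver-+ xs f (-_ ∘ g)) (+-congˡ (sumOver-neg xs g))

  sumOver-* : ∀ c xs (f : I → ℝ) → sumOver xs (λ x → c * f x) ≈ c * sumOver xs f
  sumOver-* c []       f = sym (zeroʳ c)
  sumOver-* c (x ∷ xs) f = trans (+-congˡ (sumOver-* c xs f)) (sym (distribˡ c _ _))

  sumOver-Lim : ∀ xs {f : ℕ → I → ℝ} {g} → (∀ x → Lim (λ n → f n x) (g x)) → Lim (λ n → sumOver xs (f n)) (sumOver xs g)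
  sumOver-Lim []       lim = Lim-const 0#
  sumOver-Lim (x ∷ xs) lim = Lim-+ (lim x) (sumOver-Lim xs lim)

  sumOver-split : ∀ (xs : List I) x ys f → sumOver (xs ++ x ∷ ys) f ≈ f x + sumOver (xs ++ ys) f
  sumOver-split []       x ys f = refl
  sumOver-split (z ∷ xs) x ys f = trans (+-congˡ (sumOver-split xs x ys f))
    (solve 3 (λ a b c → a :+ (b :+ c) := b :+ (a :+ c)) refl (f z) (f x) (sumOver (xs ++ ys) f))

  ∈-remove : ∀ (as : List I) {x y bs} → y ≢ x → y ∈ as ++ x ∷ bs → y ∈ as ++ bs
  ∈-remove as {bs = bs} y≢x y∈ with ∈-++⁻ as y∈
  ... | inj₁ y∈as         = ∈-++⁺ˡ y∈as
  ... | inj₂ (here y≡x)   = contradiction y≡x y≢x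
  ... | inj₂ (there y∈bs) = ∈-++⁺ʳ as y∈bs

  -- The entries of `xs` are cut out of `ys` one at a time. As `xs` has no repetitions, its
  -- remaining entries survive each cut, and what is left of `ys` at the end is nonnegative.
  sumOver-⊆ : ∀ {xs ys} {f : I → ℝ} → NonNeg f → Unique xs → xs ⊆ˡ ys → sumOver xs f ≤ sumOver ys f
  sumOver-⊆ {xs = []}     {ys} 0≤f _ _ = sumOver-nonNeg ys 0≤f
  sumOver-⊆ {xs = x ∷ xs} {f = f} 0≤f (x∉ ∷ u) xs⊆ with ∈-∃++ (xs⊆ (here ≡.refl))
  ... | as , bs , ≡.refl = ≤-trans
    (+-monoʳ-≤ (f x) (sumOver-⊆ 0≤f u λ y∈ → ∈-remove as (λ y≡x → All.lookup x∉ y∈ (≡.sym y≡x)) (xs⊆ (there y∈))))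
    (≤-reflexive (sym (sumOver-split as x bs f)))

  _≟_ : (x y : I) → Dec (x ≡ y)
  x ≟ y = decide (x ≡ y)

  dedup : List I → List I
  dedup = deduplicate _≟_

  dedup-unique : (xs : List I) → Unique (dedup xs)
  dedup-unique = deduplicate-! _≟_

  dedup-⊇ : (xs : List I) → xs ⊆ˡ dedup xs
  dedup-⊇ xs = ∈-deduplicate⁺ _≟_

  union : (xs ys : List I) → ∃ λ zs → Unique zs ∧ (xs ⊆ˡ zs) ∧ (ys ⊆ˡ zs)
  union xs ys = dedup (xs ++ ys) , dedup-unique _ , (λ x∈ → dedup-⊇ (xs ++ ys) (∈-++⁺ˡ x∈)) , (λ y∈ → dedup-⊇ (xs ++ ys) (∈-++⁺ʳ xs y∈))

  Bounds : (I → ℝ) → ℝ → Set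
  Bounds f b = ∀ xs → Unique xs → sumOver xs f ≤ b

  -- The sum of a nonnegative family, as the least upper bound of its finite sums.

  IsSum : (I → ℝ) → ℝ → Set
  IsSum f s = Bounds f s ∧ (∀ b → Bounds f b → s ≤ b)

  IsSum-cong : ∀ {f g : I → ℝ} {s t} → (∀ x → f x ≈ g x) → s ≈ t → IsSum f s → IsSum g t
  IsSum-cong f≈g s≈t (upper , least) =
    (λ xs u → ≤-trans (≤-reflexive (sumOver-cong xs (sym ∘ f≈g))) (≤-trans (upper xs u) (≤-reflexive s≈t))) ,
    λ b bound → ≤-trans (≤-reflexive (sym s≈t)) (least b λ xs u → ≤-trans (≤-reflexive (sumOver-cong xs f≈g)) (bound xs u))

  IsSum-unique : ∀ {f : I → ℝ} {s t} → IsSum f s → IsSum f t → s ≈ t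
  IsSum-unique (upperₛ , leastₛ) (upperₜ , leastₜ) = antisym (leastₛ _ upperₜ) (leastₜ _ upperₛ)

  IsSum-nonNeg : ∀ {f : I → ℝ} {s} → IsSum f s → 0# ≤ s
  IsSum-nonNeg (upper , _) = upper [] []

  IsSum-term : ∀ {f : I → ℝ} {s} → IsSum f s → ∀ x → f x ≤ s
  IsSum-term (upper , _) x = ≤-trans (≤-reflexive (sym (+-identityʳ _))) (upper (x ∷ []) ([] ∷ []))

  IsSum-mono : ∀ {f g : I → ℝ} {s t} → (∀ x → f x ≤ g x) → IsSum f s → IsSum g t → s ≤ t
  IsSum-mono f≤g (_ , least) (upper , _) = least _ λ xs u → ≤-trans (sumOver-mono xs f≤g) (upper xs u)

  IsSum-exists : ∀ {f : I → ℝ} {b} → Bounds f b → ∃ (IsSum f)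
  IsSum-exists {f = f} {b} bound =
    let s , upper , least = complete (λ r → ∃ λ xs → Unique xs ∧ r ≈ sumOver xs f) (0# , [] , [] , refl)
                              (b , λ r (xs , u , r≈) → ≤-trans (≤-reflexive r≈) (bound xs u))
    in s , (λ xs u → upper _ (xs , u , refl)) ,
       λ c bound′ → least c λ r (xs , u , r≈) → ≤-trans (≤-reflexive r≈) (bound′ xs u)

  IsSum-compare : ∀ {f g : I → ℝ} {s} → (∀ x → g x ≤ f x) → IsSum f s → ∃ (IsSum g)
  IsSum-compare g≤f (upper , _) = IsSum-exists λ xs u → ≤-trans (sumOver-mono xs g≤f) (upper xs u)

  IsSum-+ : ∀ {f g : I → ℝ} {s t} → NonNeg f → NonNeg g → IsSum f s → IsSum g t → IsSum (λ x → f x + g x) (s + t)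
  IsSum-+ {f = f} {g} {s} {t} 0≤f 0≤g (upperₛ , leastₛ) (upperₜ , leastₜ) =
    (λ xs u → ≤-trans (≤-reflexive (sumOver-+ xs f g)) (+-mono-≤ (upperₛ xs u) (upperₜ xs u))) ,
    λ b bound →
      -- The lists for f and g vary independently; a common superset brings both finite sums under
      -- b. The supremum is then taken over `xs` first and over `ys` afterwards.
      let sum≤b : ∀ xs ys → Unique xs → Unique ys → sumOver xs f + sumOver ys g ≤ b
          sum≤b xs ys uxs uys = let zs , u , xs⊆ , ys⊆ = union xs ys in
            ≤-trans (+-mono-≤ (sumOver-⊆ 0≤f uxs xs⊆) (sumOver-⊆ 0≤g uys ys⊆))
              (≤-trans (≤-reflexive (sym (sumOver-+ zs f g))) (bound zs u))
          s≤ : ∀ ys → Unique ys → s ≤ b - sumOver ys g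
          s≤ ys uys = leastₛ _ λ xs uxs → linear₁ (sum≤b xs ys uxs uys)
            (solve 3 (λ a b c → c :- b :- a := c :- (a :+ b)) refl (sumOver xs f) (sumOver ys g) b)
          t≤ : t ≤ b - s
          t≤ = leastₜ _ λ ys uys → linear₁ (s≤ ys uys)
            (solve 3 (λ a s b → b :- s :- a := b :- a :- s) refl (sumOver ys g) s b)
      in linear₁ t≤ (solve 3 (λ s t b → b :- (s :+ t) := b :- s :- t) refl s t b)

  -- The tails outside `xs` inherit the comparison because the finite sums of the nonnegative g - f
  -- grow with the list. In `dominated-Lim` this bounds all tails at once by that of the dominating
  -- family.
  IsSum-tail : ∀ {f g : I → ℝ} {s t} → (∀ x → f x ≤ g x) → NonNeg f → IsSum f s → IsSum g t →
    ∀ xs → Unique xs → s - sumOver xs f ≤ t - sumOver xs g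
  IsSum-tail {f = f} {g} {s} {t} f≤g 0≤f (_ , leastₛ) (upperₜ , _) xs uxs =
    linear₁ s≤ (solve 4 (λ s t a b → t :- b :- (s :- a) := a :+ (t :- b) :- s) refl s t (sumOver xs f) (sumOver xs g))
    where
    s≤ : s ≤ sumOver xs f + (t - sumOver xs g)
    s≤ = leastₛ _ λ ys uys →
      let zs , u , xs⊆ , ys⊆ = union xs ys
          diff = sumOver-⊆ {f = λ x → g x - f x} (λ x → ≤⇒0≤- (f≤g x)) uxs xs⊆
          diff′ = ≤-trans (≤-reflexive (sym (sumOver-- xs g f))) (≤-trans diff (≤-reflexive (sumOver-- zs g f)))
      in linear₃ (sumOver-⊆ 0≤f uys ys⊆) diff′ (upperₜ zs u)
           (solve 6 (λ t fx gx fy fz gz → fx :+ (t :- gx) :- fy := (fz :- fy) :+ (gz :- fz :- (gx :- fx)) :+ (t :- gz)) refl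
              t (sumOver xs f) (sumOver xs g) (sumOver ys f) (sumOver zs f) (sumOver zs g))

  -- That t - s is an upper bound is `IsSum-tail` rearranged. It is the least one because any bound
  -- b for g - f yields the bound b + s for g.
  IsSum-- : ∀ {f g : I → ℝ} {s t} → (∀ x → f x ≤ g x) → NonNeg f → IsSum f s → IsSum g t →
    IsSum (λ x → g x - f x) (t - s)
  IsSum-- {f = f} {g} {s} {t} f≤g 0≤f sumf@(upperₛ , _) sumg@(_ , leastₜ) =
    (λ xs u → ≤-trans (≤-reflexive (sumOver-- xs g f)) (linear₁ (IsSum-tail f≤g 0≤f sumf sumg xs u)
      (solve 4 (λ s t a b → t :- s :- (b :- a) := t :- b :- (s :- a)) refl s t (sumOver xs f) (sumOver xs g)))) ,
    λ b bound → linear₁ (leastₜ (b + s) λ xs u → linear₂ (bound xs u) (upperₛ xs u)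
        (trans (solve 4 (λ b s a c → b :+ s :- c := b :- (c :- a) :+ (s :- a)) refl b s (sumOver xs f) (sumOver xs g))
          (+-congʳ (+-congˡ (-‿cong (sym (sumOver-- xs g f)))))))
      (solve 3 (λ b s t → b :- (t :- s) := b :+ s :- t) refl b s t)

  IsSum-0 : IsSum {I} (λ _ → 0#) 0#
  IsSum-0 = (λ xs _ → ≤-reflexive (sumOver-0 xs)) , λ b bound → bound [] []

  IsSum-zero : ∀ {f : I → ℝ} → (∀ x → f x ≈ 0#) → IsSum f 0#
  IsSum-zero f≈0 = IsSum-cong (sym ∘ f≈0) refl IsSum-0

  IsSum-single : ∀ {f : I → ℝ} x₀ → 0# ≤ f x₀ → (∀ x → x ≢ x₀ → f x ≈ 0#) → IsSum f (f x₀)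
  IsSum-single {f = f} x₀ 0≤fx₀ f≈0 = upper , λ b bound → ≤-trans (≤-reflexive (sym (+-identityʳ _))) (bound (x₀ ∷ []) ([] ∷ []))
    where
    absent : ∀ xs → All (x₀ ≢_) xs → sumOver xs f ≈ 0#
    absent []       []        = refl
    absent (x ∷ xs) (x≢ ∷ xs≢) = trans (+-cong (f≈0 x (x≢ ∘ ≡.sym)) (absent xs xs≢)) (+-identityˡ 0#)
    upper : Bounds f (f x₀)
    upper []       _        = 0≤fx₀
    upper (x ∷ xs) (x∉ ∷ u) with x ≟ x₀
    ... | yes ≡.refl = ≤-reflexive (trans (+-congˡ (absent xs x∉)) (+-identityʳ _))
    ... | no x≢x₀    = ≤-trans (≤-reflexive (trans (+-congʳ (f≈0 x x≢x₀)) (+-identityˡ _))) (upper xs u)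

  -- Minimality is proved by dividing a given bound by c, so c = 0 is treated apart.
  IsSum-* : ∀ {c} {f : I → ℝ} {s} → 0# ≤ c → IsSum f s → IsSum (λ x → c * f x) (c * s)
  IsSum-* {c = c} {f} {s} 0≤c sumf@(upper , least) with decide (c ≈ 0#)
  ... | yes c≈0 = IsSum-cong (λ x → sym (trans (*-congʳ c≈0) (zeroˡ _))) (sym (trans (*-congʳ c≈0) (zeroˡ _))) IsSum-0
  ... | no c≉0  =
    (λ xs u → ≤-trans (≤-reflexive (sumOver-* c xs f)) (*-monoʳ-≤ 0≤c (upper xs u))) ,
    λ b bound → ≤-trans
      (*-monoʳ-≤ 0≤c (least (c ⁻¹ * b) λ xs u → ≤-trans (≤-reflexive (sym (cancel (sumOver xs f))))
        (*-monoʳ-≤ (⁻¹-nonNeg 0≤c) (≤-trans (≤-reflexive (sym (sumOver-* c xs f))) (bound xs u)))))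
      (≤-reflexive (trans (solve 3 (λ c i b → c :* (i :* b) := i :* (c :* b)) refl c (c ⁻¹) b) (cancel b)))
    where
    cancel : ∀ x → c ⁻¹ * (c * x) ≈ x
    cancel x = trans (solve 3 (λ c i x → i :* (c :* x) := (c :* i) :* x) refl c (c ⁻¹) x)
      (trans (*-congʳ (⁻¹-inverse c c≉0)) (*-identityˡ x))

  IsSum-sumOver : ∀ xs {f : I → J → ℝ} {s} → (∀ x → NonNeg (f x)) → (∀ x → IsSum (f x) (s x)) →
    IsSum (λ y → sumOver xs (λ x → f x y)) (sumOver xs s)
  IsSum-sumOver []       0≤f sumf = IsSum-0
  IsSum-sumOver (x ∷ xs) 0≤f sumf =
    IsSum-+ (0≤f x) (λ y → sumOver-nonNeg xs (λ x → 0≤f x y)) (sumf x) (IsSum-sumOver xs 0≤f sumf)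

  IsSum-psum : ∀ n {f : ℕ → I → ℝ} {s} → (∀ k → NonNeg (f k)) → (∀ k → IsSum (f k) (s k)) →
    IsSum (λ x → psum n (λ k → f k x)) (psum n s)
  IsSum-psum zero    0≤f sumf = IsSum-0
  IsSum-psum (suc n) 0≤f sumf =
    IsSum-+ (0≤f 0) (λ x → psum-nonNeg n λ k → 0≤f (suc k) x) (sumf 0) (IsSum-psum n (0≤f ∘ suc) (sumf ∘ suc))

  -- Both totals are suprema over finite rectangles: for finitely many columns the sum over the rows
  -- commutes with the finite sum, every finite part of it is at most the total of the row sums, and
  -- the same holds with the roles exchanged.
  tonelli : ∀ {f : I → J → ℝ} {r c s} → (∀ x y → 0# ≤ f x y) →
    (∀ x → IsSum (f x) (r x)) → (∀ y → IsSum (λ x → f x y) (c y)) → IsSum r s → IsSum c s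
  tonelli {f = f} {r} {c} {s} 0≤f rows columns (upper , least) =
    (λ ys u → proj₂ (IsSum-sumOver ys (λ y x → 0≤f x y) columns) s λ xs uxs →
      ≤-trans (sumOver-mono xs λ x → proj₁ (rows x) ys u) (upper xs uxs)) ,
    λ b bound → least b λ xs u → proj₂ (IsSum-sumOver xs 0≤f rows) b λ ys uys →
      ≤-trans (sumOver-mono ys λ y → proj₁ (columns y) xs u) (bound ys uys)

  IsSum-approx : ∀ {f : I → ℝ} {s} → IsSum f s → ∀ ε → 0# < ε →
    ∃ λ xs → Unique xs ∧ (s - ε < sumOver xs f)
  IsSum-approx {f = f} {s} (_ , least) ε 0<ε with decide (∃ λ xs → Unique xs ∧ (s - ε < sumOver xs f))
  ... | yes approx = approx
  ... | no ∄       = ⊥-elim (proj₂ (proj₁ (<-shrink 0<ε)) (antisym (proj₁ (proj₁ (<-shrink 0<ε)))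
      (least (s - ε) λ xs u → ≤-by-contra λ s-ε< → contradiction (xs , u , s-ε<) ∄)))

  -- A finite list carries all but ε/2 of the sum of w. Outside it the sums of `g n` and of `g∞` are
  -- at most ε/2, whatever n is; on it the convergence is that of a finite sum.
  dominated-Lim : ∀ {g : ℕ → I → ℝ} {g∞ w s s∞ t} →
    (∀ n → NonNeg (g n)) → (∀ n x → g n x ≤ w x) → IsSum w t →
    (∀ n → IsSum (g n) (s n)) → IsSum g∞ s∞ → (∀ x → Lim (λ n → g n x) (g∞ x)) → Lim s s∞
  dominated-Lim {g = g} {g∞} {w} {s} {s∞} {t} 0≤g g≤w sumw sumg sumg∞ limg ε 0<ε =
    let δ  = half ε
        0<δ = half-pos 0<ε
        xs , u , approx = IsSum-approx sumw δ 0<δ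
        N , near = sumOver-Lim xs limg δ 0<δ
        0≤g∞ = λ x → Lim-≥ (λ n → 0≤g n x) (limg x)
        g∞≤w = λ x → Lim-≤ (λ n → g≤w n x) (limg x)
        small = linear₁ (proj₁ approx) (solve 3 (λ t w δ → δ :- (t :- w) := w :- (t :- δ)) refl t (sumOver xs w) δ)
    in N , λ n N≤n →
      linear₃ (≤-trans (IsSum-tail g∞≤w 0≤g∞ sumg∞ sumw xs u) small)
        (≤-trans (proj₁ (near n N≤n)) (proj₁ (sumg n) xs u)) (≤-reflexive (half+half ε))
        (solve 5 (λ s s∞ σ δ ε → s :- (s∞ :- ε) := (δ :- (s∞ :- σ)) :+ (s :- (σ :- δ)) :+ (ε :- (δ :+ δ))) refl
          (s n) s∞ (sumOver xs g∞) δ ε) ,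
      linear₃ (≤-trans (IsSum-tail (g≤w n) (0≤g n) (sumg n) sumw xs u) small)
        (≤-trans (proj₂ (near n N≤n)) (+-monoˡ-≤ δ (proj₁ sumg∞ xs u))) (≤-reflexive (half+half ε))
        (solve 5 (λ s s∞ σ δ ε → s∞ :+ ε :- s := (δ :- (s :- σ)) :+ (s∞ :+ δ :- σ) :+ (ε :- (δ :+ δ))) refl
          (s n) s∞ (sumOver xs (g n)) δ ε)

  -- Here the limit of the sums is known and the sum of the limit family is wanted; comparison with
  -- w shows that the latter exists, and uniqueness of limits gives its value.
  dominated-IsSum : ∀ {g : ℕ → I → ℝ} {g∞ w s s∞ t} →
    (∀ n → NonNeg (g n)) → (∀ n x → g n x ≤ w x) → IsSum w t →
    (∀ n → IsSum (g n) (s n)) → (∀ x → Lim (λ n → g n x) (g∞ x)) → Lim s s∞ → IsSum g∞ s∞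
  dominated-IsSum 0≤g g≤w sumw sumg limg lims =
    let _ , sumg∞ = IsSum-compare (λ x → Lim-≤ (λ n → g≤w n x) (limg x)) sumw
    in IsSum-cong (λ _ → refl) (Lim-unique (dominated-Lim 0≤g g≤w sumw sumg sumg∞ limg) lims) sumg∞

  HasSum⇒IsSum : ∀ {f : I → ℝ} {s} → NonNeg f → HasSum f s → IsSum f s
  HasSum⇒IsSum {f = f} {s} 0≤f hs =
    (λ xs u → ≤-ε λ ε 0<ε → let ys , near = hs ε 0<ε
                                zs , uzs , xs⊆ , ys⊆ = union xs ys
      in ≤-trans (sumOver-⊆ 0≤f u xs⊆) (proj₁ (proj₂ (near zs uzs ys⊆)))) ,
    -- The list that witnesses the limit may have repetitions, so it is deduplicated before `near`
    -- and `bound` are applied.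
    λ b bound → ≤-ε λ ε 0<ε → let ys , near = hs ε 0<ε
                                  u = dedup-unique ys
      in linear₂ (proj₁ (proj₁ (near (dedup ys) u (dedup-⊇ ys)))) (bound (dedup ys) u)
           (solve 4 (λ b ε s a → b :+ ε :- s := a :- (s :- ε) :+ (b :- a)) refl b ε s (sumOver (dedup ys) f))

  IsSum⇒HasSum : ∀ {f : I → ℝ} {s} → NonNeg f → IsSum f s → HasSum f s
  IsSum⇒HasSum 0≤f sumf@(upper , _) ε 0<ε =
    let xs , uxs , approx = IsSum-approx sumf ε 0<ε
    in xs , λ ys uys xs⊆ → <-≤-trans approx (sumOver-⊆ 0≤f uxs xs⊆) , ≤-<-trans (upper ys uys) (proj₂ (<-shrink 0<ε))

  ∑-correct : ∀ {f : I → ℝ} → Summable f → HasSum f (∑ f)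
  ∑-correct {f = f} smb with decide (Summable f)
  ... | yes (_ , hs) = hs
  ... | no ¬smb      = contradiction smb ¬smb

  IsSum-∑ : ∀ {f : I → ℝ} {s} → NonNeg f → IsSum f s → IsSum f (∑ f)
  IsSum-∑ {f = f} {s} 0≤f sumf = HasSum⇒IsSum 0≤f (∑-correct (s , IsSum⇒HasSum 0≤f sumf))

-- Powers of a transition matrix

module TransitionMatrices (em : ExcludedMiddle (lsuc 0ℓ)) (R : CompleteOrderedField) where

  open CompleteOrderedField R
  open Theory em R
  open IntegerSolver commutativeRing
  open OrderedField em R
  open Sums em R

  module Powers {S : Set} (P : S → S → ℝ) (isTM : IsTransitionMatrix P) where

    P-nonNeg : ∀ j l → 0# ≤ P j l
    P-nonNeg = IsTransitionMatrix.nonNeg isTM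

    P-row : ∀ j → IsSum (P j) 1#
    P-row j = HasSum⇒IsSum (P-nonNeg j) (IsTransitionMatrix.row isTM j)

    P≤1 : ∀ j l → P j l ≤ 1#
    P≤1 j = IsSum-term (P-row j)

    P-average : ∀ q c → 0# ≤ c → IsSum (λ m → P q m * c) c
    P-average q c 0≤c = IsSum-cong (λ m → *-comm c _) (*-identityʳ c) (IsSum-* 0≤c (P-row q))

    power-nonNeg : ∀ t j l → 0# ≤ power P t j l
    power-row    : ∀ t j → IsSum (power P t j) 1#
    power-suc    : ∀ t j l → IsSum (λ m → power P t j m * P m l) (power P (suc t) j l)

    power-nonNeg zero    j l = 𝟙-nonNeg (_≡ l) j
    power-nonNeg (suc t) j l = IsSum-nonNeg (power-suc t j l)

    power-row zero    j = IsSum-cong (λ _ → refl) (𝟙-yes (_≡ j) ≡.refl)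
      (IsSum-single j (𝟙-nonNeg (_≡ j) j) λ l l≢j → 𝟙-no (_≡ l) (l≢j ∘ ≡.sym))
    power-row (suc t) j = tonelli (λ m l → *-nonNeg (power-nonNeg t j m) (P-nonNeg m l))
      (λ m → IsSum-* (power-nonNeg t j m) (P-row m)) (power-suc t j)
      (IsSum-cong (λ m → sym (*-identityʳ _)) refl (power-row t j))

    power-suc t j l = IsSum-∑ (λ m → *-nonNeg (power-nonNeg t j m) (P-nonNeg m l))
      (proj₂ (IsSum-compare (λ m → ≤-trans (*-monoʳ-≤ (power-nonNeg t j m) (P≤1 m l)) (≤-reflexive (*-identityʳ _))) (power-row t j)))

    power≤1 : ∀ t j l → power P t j l ≤ 1#
    power≤1 t j = IsSum-term (power-row t j)

    power-0-refl : ∀ j → power P 0 j j ≈ 1#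
    power-0-refl j = 𝟙-yes (_≡ j) ≡.refl

    power-0-≢ : ∀ {j l} → j ≢ l → power P 0 j l ≈ 0#
    power-0-≢ {j} {l} = 𝟙-no (_≡ l)

    -- `power` splits off the last step, whereas conditioning on the first step needs the first one
    -- split off. The two expansions are reconciled by `tonelli`, by induction on t.
    power-sucˡ : ∀ t j l → IsSum (λ m → P j m * power P t m l) (power P (suc t) j l)
    power-sucˡ zero    j l = IsSum-cong (λ _ → refl)
      (trans (trans (*-congˡ (power-0-refl l)) (trans (*-comm _ _) (*-congʳ (sym (power-0-refl j)))))
        (IsSum-unique
          (IsSum-single j (*-nonNeg (power-nonNeg 0 j j) (P-nonNeg j l)) λ m m≢j →
            trans (*-congʳ (power-0-≢ (m≢j ∘ ≡.sym))) (zeroˡ _))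
          (power-suc 0 j l)))
      (IsSum-single l (*-nonNeg (P-nonNeg j l) (power-nonNeg 0 l l)) λ m m≢l → trans (*-congˡ (power-0-≢ m≢l)) (zeroʳ _))
    power-sucˡ (suc t) j l = tonelli
      (λ k m → *-nonNeg (P-nonNeg k l) (*-nonNeg (P-nonNeg j m) (power-nonNeg t m k)))
      (λ k → IsSum-* (P-nonNeg k l) (power-sucˡ t j k))
      (λ m → IsSum-cong (λ k → solve 3 (λ a b c → a :* (b :* c) := c :* (a :* b)) refl (P j m) (power P t m k) (P k l)) refl
        (IsSum-* (P-nonNeg j m) (power-suc t m l)))
      (IsSum-cong (λ k → *-comm _ _) refl (power-suc (suc t) j l))

    -- The distribution a t of the chain started at i and killed upon its
    -- return to i, and its total mass p t.

    record KilledChain (i : S) : Set where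
      field
        a        : ℕ → S → ℝ
        p        : ℕ → ℝ
        C        : ℝ
        a-nonNeg : ∀ t → NonNeg (a t)
        a-start  : a 0 i ≈ 1#
        a-0-≢    : ∀ {q} → q ≢ i → a 0 q ≈ 0#
        a-killed : ∀ t → a (suc t) i ≈ 0#
        a-suc    : ∀ t {q} → q ≢ i → IsSum (λ m → a t m * P m q) (a (suc t) q)
        a-mass   : ∀ t → IsSum (a t) (p t)
        p-bound  : ∀ n → psum n p ≤ C

    -- The excursion identity for the killed chain

    module Excursion {i : S} (killed : KilledChain i) {πi : ℝ} (power⟶πi : ∀ j → Lim (λ t → power P t j i) πi)
      {h∞ : S → ℝ} (h⟶h∞ : ∀ j → Lim (λ n → psum n (λ t → power P t i i) - psum n (λ t → power P t j i)) (h∞ j)) where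

      open KilledChain killed

      p-nonNeg : ∀ t → 0# ≤ p t
      p-nonNeg t = IsSum-nonNeg (a-mass t)

      -- Expected numbers of visits to i from q: at the times 0, ..., n - 1 for `G n q`, and at the
      -- times 1, ..., n for `G⁺ n q`.
      G G⁺ : ℕ → S → ℝ
      G  n q = psum n (λ t → power P t q i)
      G⁺ n q = psum n (λ t → power P (suc t) q i)

      h : ℕ → S → ℝ
      h n q = G n i - G n q

      G⁺≈ : ∀ n q → power P 0 q i + G⁺ n q ≈ G n q + power P n q i
      G⁺≈ n q = psum-suc n (λ t → power P t q i)

      G-nonNeg : ∀ n q → 0# ≤ G n q
      G-nonNeg n q = psum-nonNeg n λ t → power-nonNeg t q i

      G-average : ∀ n q → IsSum (λ m → P q m * G n m) (G⁺ n q)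
      G-average n q = IsSum-cong (λ m → sym (psum-* (P q m) n (λ t → power P t m i))) refl
        (IsSum-psum n (λ t m → *-nonNeg (P-nonNeg q m) (power-nonNeg t m i)) (λ t → power-sucˡ t q i))

      h-i : ∀ n → h n i ≈ 0#
      h-i n = -‿inverseʳ _

      -- The induction on n is mutual: `h n ≥ 0` is the comparison that permits the subtraction in
      -- `h-average`, and the nonnegative average so obtained gives `h (suc n) ≥ 0` through `h-suc`.
      h-nonNeg : ∀ n → NonNeg (h n)
      h-average : ∀ n q → IsSum (λ m → P q m * h n m) (G n i - G⁺ n q)
      h-suc : ∀ n {q} → q ≢ i → h (suc n) q ≈ (G n i - G⁺ n q) + power P n i i

      h-average n q = IsSum-cong (λ m → solve 3 (λ p x y → p :* x :- p :* y := p :* (x :- y)) refl (P q m) (G n i) (G n m)) refl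
        (IsSum-- (λ m → *-monoʳ-≤ (P-nonNeg q m) (0≤-⇒≤ (h-nonNeg n m))) (λ m → *-nonNeg (P-nonNeg q m) (G-nonNeg n m))
          (G-average n q) (P-average q (G n i) (G-nonNeg n i)))

      h-suc n {q} q≢i = begin
        h (suc n) q
          ≈⟨ +-congʳ (psum-suc n (λ t → power P t i i)) ⟩
        G n i + power P n i i - (power P 0 q i + G⁺ n q)
          ≈⟨ +-congˡ (-‿cong (trans (+-congʳ (power-0-≢ q≢i)) (+-identityˡ _))) ⟩
        G n i + power P n i i - G⁺ n q
          ≈⟨ solve 3 (λ x y z → x :+ y :- z := x :- z :+ y) refl (G n i) (power P n i i) (G⁺ n q) ⟩
        (G n i - G⁺ n q) + power P n i i ∎
        where open import Relation.Binary.Reasoning.Setoid setoid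

      h-nonNeg zero    q = ≤-reflexive (sym (-‿inverseʳ 0#))
      h-nonNeg (suc n) q with decide (q ≡ i)
      ... | yes ≡.refl = ≤-reflexive (sym (-‿inverseʳ _))
      ... | no q≢i     = ≤-trans (+-nonNeg (IsSum-nonNeg (h-average n q)) (power-nonNeg n i i)) (≤-reflexive (sym (h-suc n q≢i)))

      b-exists : ∀ t n → ∃ (IsSum (λ m → a t m * power P n m i))
      b-exists t n = IsSum-compare (λ m → ≤-trans (*-monoʳ-≤ (a-nonNeg t m) (power≤1 n m i)) (≤-reflexive (*-identityʳ _))) (a-mass t)

      -- For the chain itself this is ℙ_i(T_i > t, X_{t+n} = i).
      b : ℕ → ℕ → ℝ
      b t n = proj₁ (b-exists t n)

      -- Powers are at most 1, so the mass `a t` itself dominates.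
      b⟶ : ∀ t → Lim (b t) (πi * p t)
      b⟶ t = dominated-Lim (λ n m → *-nonNeg (a-nonNeg t m) (power-nonNeg n m i))
        (λ n m → ≤-trans (*-monoʳ-≤ (a-nonNeg t m) (power≤1 n m i)) (≤-reflexive (*-identityʳ _))) (a-mass t)
        (λ n → proj₂ (b-exists t n)) (IsSum-cong (λ m → *-comm _ _) refl (IsSum-* 0≤πi (a-mass t)))
        (λ m → Lim-scale (a-nonNeg t m) (power⟶πi m))
        where
        0≤πi : 0# ≤ πi
        0≤πi = Lim-≥ (λ t → power-nonNeg t i i) (power⟶πi i)

      -- For a function that vanishes at i, a step of the killed chain is dual to averaging with P:
      -- the mass that is lost upon the return to i would have been multiplied by `f i ≈ 0#`.
      transfer : ∀ t {f : S → ℝ} {r : S → ℝ} {s} → NonNeg f → f i ≈ 0# → (∀ m → IsSum (λ q → P m q * f q) (r m)) →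
        IsSum (λ m → a t m * r m) s → IsSum (λ q → a (suc t) q * f q) s
      transfer t {f} 0≤f fi≈0 average = tonelli
        (λ m q → *-nonNeg (a-nonNeg t m) (*-nonNeg (P-nonNeg m q) (0≤f q)))
        (λ m → IsSum-* (a-nonNeg t m) (average m)) column
        where
        column : ∀ q → IsSum (λ m → a t m * (P m q * f q)) (a (suc t) q * f q)
        column q with decide (q ≡ i)
        ... | yes ≡.refl = IsSum-cong (λ _ → refl) (sym (trans (*-congˡ fi≈0) (zeroʳ _)))
              (IsSum-zero λ m → trans (*-congˡ (trans (*-congˡ fi≈0) (zeroʳ _))) (zeroʳ _))
        ... | no q≢i     = IsSum-cong (λ m → solve 3 (λ f a p → f :* (a :* p) := a :* (p :* f)) refl (f q) (a t m) (P m q)) (*-comm _ _)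
              (IsSum-* (0≤f q) (a-suc t q≢i))

      -- By `transfer` the new sum is that of `a t` against the averages of `h n`. Since `G` and
      -- `G⁺` differ only in their end terms, such an average is h_n(m) + 1_{m=i} - P^n_mi, where
      -- `power P 0 m i` serves as the indicator. Its nonnegativity is what allows the last term to
      -- be subtracted.
      ah-suc : ∀ t n {α} → IsSum (λ q → a t q * h n q) α → IsSum (λ q → a (suc t) q * h n q) (α + a t i - b t n)
      ah-suc t n {α} sumα = transfer t (h-nonNeg n) (h-i n) (h-average n)
        (IsSum-cong
          (λ m → trans (solve 4 (λ a h d x → a :* h :+ a :* d :- a :* x := a :* (h :+ d :- x)) refl (a t m) (h n m) (power P 0 m i) (power P n m i))
                       (*-congˡ (value m)))
          (+-congʳ (+-congˡ (trans (*-congˡ (power-0-refl i)) (*-identityʳ _))))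
          (IsSum--
            (λ m → ≤-trans (*-monoʳ-≤ (a-nonNeg t m) (0≤-⇒≤ (≤-trans (IsSum-nonNeg (h-average n m)) (≤-reflexive (sym (value m))))))
                           (≤-reflexive (distribˡ _ _ _)))
            (λ m → *-nonNeg (a-nonNeg t m) (power-nonNeg n m i)) (proj₂ (b-exists t n))
            (IsSum-+ (λ m → *-nonNeg (a-nonNeg t m) (h-nonNeg n m)) (λ m → *-nonNeg (a-nonNeg t m) (power-nonNeg 0 m i)) sumα
              (IsSum-single i (*-nonNeg (a-nonNeg t i) (power-nonNeg 0 i i)) λ m m≢i → trans (*-congˡ (power-0-≢ m≢i)) (zeroʳ _)))))
        where
        value : ∀ m → h n m + power P 0 m i - power P n m i ≈ G n i - G⁺ n m
        value m = trans
          (solve 4 (λ gi g d x → gi :- g :+ d :- x := gi :+ d :- (g :+ x)) refl (G n i) (G n m) (power P 0 m i) (power P n m i))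
          (trans (+-congˡ (-‿cong (sym (G⁺≈ n m))))
            (solve 3 (λ gi d g → gi :+ d :- (d :+ g) := gi :- g) refl (G n i) (power P 0 m i) (G⁺ n m)))

      -- The sum of the one-step identities telescopes. It starts from 0, because `a 0` sits at i,
      -- where `h n` vanishes; the 1 is a_0(i), and a_t(i) = 0 at all later times.
      ah-sum : ∀ t n → IsSum (λ q → a (suc t) q * h n q) (1# - psum (suc t) (λ s → b s n))
      ah-sum zero    n = IsSum-cong (λ _ → refl)
        (trans (+-congʳ (+-congˡ a-start)) (solve 1 (λ b → :0 :+ :1 :- b := :1 :- (b :+ :0)) refl (b 0 n)))
        (ah-suc 0 n (IsSum-zero off))
        where
        off : ∀ q → a 0 q * h n q ≈ 0#
        off q with decide (q ≡ i)
        ... | yes ≡.refl = trans (*-congˡ (h-i n)) (zeroʳ _)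
        ... | no q≢i     = trans (*-congʳ (a-0-≢ q≢i)) (zeroˡ _)
      ah-sum (suc t) n = IsSum-cong (λ _ → refl)
        (trans (+-congʳ (+-congˡ (a-killed t)))
          (trans (solve 3 (λ o s b → o :- s :+ :0 :- b := o :- (s :+ b)) refl 1# (psum (suc t) (λ s → b s n)) (b (suc t) n))
            (+-congˡ (-‿cong (sym (psum-suc (suc t) (λ s → b s n)))))))
        (ah-suc (suc t) n (ah-sum t n))

      -- v n q is the expected time to reach i from q, truncated at n.  It
      -- dominates h n q.

      v : ℕ → S → ℝ
      v zero    q = 0#
      v (suc n) q = 𝟙 (_≢ i) q * (1# + ∑ (λ m → P q m * v n m))

      -- These three are proved together: the bound by n makes the sums in `v` converge, so that ∑
      -- is an actual sum there and not its default value 0.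
      v-nonNeg  : ∀ n → NonNeg (v n)
      v-bound   : ∀ n q → v n q ≤ fromℕ n
      v-average : ∀ n q → IsSum (λ m → P q m * v n m) (∑ (λ m → P q m * v n m))

      v-average n q = IsSum-∑ (λ m → *-nonNeg (P-nonNeg q m) (v-nonNeg n m))
        (proj₂ (IsSum-compare (λ m → *-monoʳ-≤ (P-nonNeg q m) (v-bound n m)) (P-average q (fromℕ n) (fromℕ-nonNeg n))))

      v-i : ∀ n → v n i ≈ 0#
      v-i zero    = refl
      v-i (suc n) = trans (*-congʳ (𝟙-no (_≢ i) λ i≢i → i≢i ≡.refl)) (zeroˡ _)

      v-suc : ∀ n {q} → q ≢ i → v (suc n) q ≈ 1# + ∑ (λ m → P q m * v n m)
      v-suc n q≢i = trans (*-congʳ (𝟙-yes (_≢ i) q≢i)) (*-identityˡ _)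

      v-nonNeg zero    q = ≤-refl
      v-nonNeg (suc n) q = *-nonNeg (𝟙-nonNeg (_≢ i) q) (+-nonNeg 0≤1 (IsSum-nonNeg (v-average n q)))

      v-bound zero    q = ≤-refl
      v-bound (suc n) q with decide (q ≡ i)
      ... | yes ≡.refl = ≤-trans (≤-reflexive (v-i (suc n))) (fromℕ-nonNeg (suc n))
      ... | no q≢i     = ≤-trans (≤-reflexive (v-suc n q≢i)) (+-monoʳ-≤ 1#
            (IsSum-mono (λ m → *-monoʳ-≤ (P-nonNeg q m) (v-bound n m)) (v-average n q) (P-average q (fromℕ n) (fromℕ-nonNeg n))))

      v-mono : ∀ n q → v n q ≤ v (suc n) q
      v-mono zero    q = v-nonNeg 1 q
      v-mono (suc n) q = *-monoʳ-≤ (𝟙-nonNeg (_≢ i) q) (+-monoʳ-≤ 1#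
        (IsSum-mono (λ m → *-monoʳ-≤ (P-nonNeg q m) (v-mono n m)) (v-average n q) (v-average (suc n) q)))

      -- Off i both sides satisfy the same recursion, with increment P^n_ii ≤ 1 on the left and 1 on
      -- the right.
      h≤v : ∀ n q → h n q ≤ v n q
      h≤v zero    q = ≤-reflexive (-‿inverseʳ 0#)
      h≤v (suc n) q with decide (q ≡ i)
      ... | yes ≡.refl = ≤-reflexive (trans (h-i (suc n)) (sym (v-i (suc n))))
      ... | no q≢i     = ≤-trans (≤-reflexive (trans (h-suc n q≢i) (+-comm _ _))) (≤-trans
            (+-mono-≤ (power≤1 n i i) (IsSum-mono (λ m → *-monoʳ-≤ (P-nonNeg q m) (h≤v n m)) (h-average n q) (v-average n q)))
            (≤-reflexive (sym (v-suc n q≢i))))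

      -- For the chain itself both sides are the expectation of min(T_i - (t + 1), n) on T_i > t +
      -- 1. Each step counts the present mass once and hands the remaining time over to the next
      -- state.
      av-sum : ∀ n t → IsSum (λ q → a (suc t) q * v n q) (psum n (λ s → p (s ℕ.+ suc t)))
      av-sum zero    t = IsSum-zero λ q → zeroʳ _
      av-sum (suc n) t = IsSum-cong split (+-congˡ (psum-cong n λ s _ → reflexive (≡.cong p (ℕₚ.+-suc s (suc t)))))
        (IsSum-+ (a-nonNeg (suc t)) (λ q → *-nonNeg (a-nonNeg (suc t) q) (IsSum-nonNeg (v-average n q))) (a-mass (suc t))
          (transferᵒ (av-sum n (suc t))))
        where
        split : ∀ q → a (suc t) q + a (suc t) q * ∑ (λ m → P q m * v n m) ≈ a (suc t) q * v (suc n) q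
        split q with decide (q ≡ i)
        ... | yes ≡.refl = trans (+-cong (a-killed t) (trans (*-congʳ (a-killed t)) (zeroˡ _)))
              (trans (+-identityˡ 0#) (sym (trans (*-congʳ (a-killed t)) (zeroˡ _))))
        ... | no q≢i     = trans (+-congʳ (sym (*-identityʳ _))) (trans (sym (distribˡ _ _ _)) (*-congˡ (sym (v-suc n q≢i))))
        -- `transfer` leads from time `suc t` to the next and presupposes that the earlier sum
        -- exists. The crude bound v_n ≤ n gives existence, and uniqueness then identifies the
        -- value.
        transferᵒ : ∀ {s} → IsSum (λ q → a (suc (suc t)) q * v n q) s →
                    IsSum (λ q → a (suc t) q * ∑ (λ m → P q m * v n m)) s
        transferᵒ sum = let s′ , sum′ = IsSum-exists {b = fromℕ n * p (suc t)} bound in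
          IsSum-cong (λ _ → refl) (IsSum-unique (transfer (suc t) (v-nonNeg n) (v-i n) (v-average n) sum′) sum) sum′
          where
          bound : Bounds (λ q → a (suc t) q * ∑ (λ m → P q m * v n m)) (fromℕ n * p (suc t))
          bound xs u = ≤-trans
            (sumOver-mono xs λ q → ≤-trans (*-monoʳ-≤ (a-nonNeg (suc t) q)
              (IsSum-mono (λ m → *-monoʳ-≤ (P-nonNeg q m) (v-bound n m)) (v-average n q) (P-average q (fromℕ n) (fromℕ-nonNeg n))))
              (≤-reflexive (*-comm _ _)))
            (proj₁ (IsSum-* (fromℕ-nonNeg n) (a-mass (suc t))) xs u)

      -- The bound does not depend on n; this is how the finite expected return time enters the
      -- passage to the limit.
      av-bound : ∀ n t → Bounds (λ q → a (suc t) q * v n q) C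
      av-bound n t xs u = ≤-trans (proj₁ (av-sum n t) xs u) (≤-trans (psum-shift-≤ p-nonNeg (suc t) n) (p-bound (n ℕ.+ suc t)))

      excursion-identity : ∀ t → IsSum (λ q → a (suc t) q * h∞ q) (1# - πi * psum (suc t) p)
      excursion-identity t = dominated-IsSum
        (λ n q → *-nonNeg (a-nonNeg (suc t) q) (h-nonNeg n q))
        (λ n q → ≤-trans (*-monoʳ-≤ (a-nonNeg (suc t) q) (h≤v n q)) (proj₂ (proj₂ (limit q)) n))
        -- The dominating family consists of the limits of `a (suc t) q * v n q` as n grows. Each of
        -- its finite sums is a limit of finite sums that are at most C.
        (proj₂ (IsSum-exists λ xs u → Lim-≤ (λ n → av-bound n t xs u) (sumOver-Lim xs (λ q → proj₁ (proj₂ (limit q))))))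
        (ah-sum t) (λ q → Lim-scale (a-nonNeg (suc t) q) (h⟶h∞ q))
        (Lim-cong (λ _ → refl) (+-congˡ (-‿cong (sym (psum-* πi (suc t) p)))) (Lim-+ (Lim-const 1#) (Lim-neg (Lim-psum (suc t) b⟶))))
        where
        -- The limit is that of the product, since `av-bound` controls `v n q` only where the mass
        -- `a (suc t) q` is nonzero.
        limit : ∀ q → ∃ λ l → Lim (λ n → a (suc t) q * v n q) l ∧ (∀ n → a (suc t) q * v n q ≤ l)
        limit q = monotone-convergence (λ n → *-monoʳ-≤ (a-nonNeg (suc t) q) (v-mono n q))
          (λ n → ≤-trans (≤-reflexive (sym (+-identityʳ _))) (av-bound n t (q ∷ []) ([] ∷ [])))

-- Finite additivity, integrals of simple functions and countable partitions

module Probability (em : ExcludedMiddle (lsuc 0ℓ)) (R : CompleteOrderedField) where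

  open CompleteOrderedField R
  open Theory em R
  open IntegerSolver commutativeRing
  open OrderedField em R
  open Sums em R
  open SupremumStrict _<_ using (_<⁺_)

  ¬¬-elim : ∀ {A : Set} → ¬ ¬ A → A
  ¬¬-elim = decidable-stable (decide _)

  module Measurability (M : MeasurableSpace) where

    open MeasurableSpace M

    measurable-∅ : Measurable ∅
    measurable-∅ = measurable-≐ ((λ ¬u → ¬u _) , (λ ())) (measurable-∁ measurable-U)

    -- The axioms speak of sequences of events; two events are padded with empty ones.
    pair : Pred Ω 0ℓ → Pred Ω 0ℓ → ℕ → Pred Ω 0ℓ
    pair A B zero          = A
    pair A B (suc zero)    = B
    pair A B (suc (suc _)) = ∅

    ⋃-pair : ∀ {A B} → ⋃ ℕ (pair A B) ≐ A ∪ B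
    ⋃-pair = (λ { (zero , a) → inj₁ a ; (suc zero , b) → inj₂ b ; (suc (suc _) , ()) }) , [ (0 ,_) , (1 ,_) ]′

    pair-measurable : ∀ {A B} → Measurable A → Measurable B → ∀ n → Measurable (pair A B n)
    pair-measurable mA mB zero          = mA
    pair-measurable mA mB (suc zero)    = mB
    pair-measurable mA mB (suc (suc _)) = measurable-∅

    measurable-∪ : ∀ {A B} → Measurable A → Measurable B → Measurable (A ∪ B)
    measurable-∪ mA mB = measurable-≐ ⋃-pair (measurable-⋃ _ (pair-measurable mA mB))

    measurable-∩ : ∀ {A B} → Measurable A → Measurable B → Measurable (A ∩ B)
    measurable-∩ mA mB = measurable-≐
      ((λ n → ¬¬-elim (n ∘ inj₁) , ¬¬-elim (n ∘ inj₂)) , λ (a , b) → [ (λ ¬a → ¬a a) , (λ ¬b → ¬b b) ]′)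
      (measurable-∁ (measurable-∪ (measurable-∁ mA) (measurable-∁ mB)))

  module Measure {M : MeasurableSpace} (μ : ProbabilityMeasure M) where

    open MeasurableSpace M
    open Measurability M
    open ProbabilityMeasure μ

    -- Additivity for the constant sequence ∅ makes a constant series converge, so its terms tend to
    -- 0.
    ℙ-∅ : ℙ ∅ ≈ 0#
    ℙ-∅ = Lim-unique (Lim-const _) (HasSeries⇒Lim0 {λ _ → ℙ ∅} (ℙ-additive (λ _ → ∅) (λ _ → measurable-∅) (λ _ _ _ _ ())))

    ℙ-empty : ∀ {A} → (∀ ω → ¬ A ω) → ℙ A ≈ 0#
    ℙ-empty ¬A = trans (sym (ℙ-cong ((λ ()) , λ {ω} a → ¬A ω a) measurable-∅)) ℙ-∅

    ℙ-∪ : ∀ {A B} → Measurable A → Measurable B → (∀ ω → A ω → ¬ B ω) → ℙ (A ∪ B) ≈ ℙ A + ℙ B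
    ℙ-∪ {A} {B} mA mB disjoint = trans
      (sym (ℙ-cong ⋃-pair (measurable-⋃ _ (pair-measurable mA mB))))
      (Lim-unique (Lim-suc (Lim-suc (HasSeries⇒Lim {ℙ ∘ pair A B} (ℙ-additive (pair A B) (pair-measurable mA mB) disj))))
        (Lim-cong (λ n → sym (partial n)) refl (Lim-const (ℙ A + ℙ B))))
      where
      disj : ∀ m n → m ≢ n → ∀ ω → ¬ (pair A B m ∩ pair A B n) ω
      disj zero          zero          m≢n ω _       = m≢n ≡.refl
      disj zero          (suc zero)    m≢n ω (a , b) = disjoint ω a b
      disj (suc zero)    zero          m≢n ω (b , a) = disjoint ω a b
      disj (suc zero)    (suc zero)    m≢n ω _       = m≢n ≡.refl
      disj (suc (suc _)) n             m≢n ω (() , _)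
      disj zero          (suc (suc _)) m≢n ω (_ , ())
      disj (suc zero)    (suc (suc _)) m≢n ω (_ , ())
      zeros : ∀ n → psum n (λ _ → ℙ ∅) ≈ 0#
      zeros zero    = refl
      zeros (suc n) = trans (+-cong ℙ-∅ (zeros n)) (+-identityˡ 0#)
      partial : ∀ n → psum (suc (suc n)) (ℙ ∘ pair A B) ≈ ℙ A + ℙ B
      partial n = +-congˡ (trans (+-congˡ (zeros n)) (+-identityʳ _))

    ℙ-split : ∀ {A} B → Measurable A → Measurable B → ℙ A ≈ ℙ (A ∩ B) + ℙ (A ∩ ∁ B)
    ℙ-split {A} B mA mB = trans
      (ℙ-cong ((λ {ω} a → split ω a) , [ proj₁ , proj₁ ]′) mA)
      (ℙ-∪ (measurable-∩ mA mB) (measurable-∩ mA (measurable-∁ mB)) λ ω (_ , b) (_ , ¬b) → ¬b b)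
      where
      split : ∀ ω → A ω → ((A ∩ B) ∪ (A ∩ ∁ B)) ω
      split ω a with decide (B ω)
      ... | yes b = inj₁ (a , b)
      ... | no ¬b = inj₂ (a , ¬b)

    ℙ-mono : ∀ {A B} → Measurable A → Measurable B → (∀ {ω} → A ω → B ω) → ℙ A ≤ ℙ B
    ℙ-mono {A} {B} mA mB A⊆B = ≤-trans
      (linear₁ (ℙ-nonNeg (measurable-∩ mB (measurable-∁ mA))) (solve 2 (λ x y → x :+ y :- x := y :- :0) refl (ℙ A) (ℙ (B ∩ ∁ A))))
      (≤-reflexive (sym (trans (ℙ-split A mB mA) (+-congʳ (sym (ℙ-cong ((λ a → A⊆B a , a) , proj₂) mA))))))

    ℙ-null : ∀ {A B} → Measurable A → Measurable B → (∀ {ω} → A ω → B ω) → ℙ B ≈ 0# → ℙ A ≈ 0#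
    ℙ-null mA mB A⊆B ℙB≈0 = antisym (≤-trans (ℙ-mono mA mB A⊆B) (≤-reflexive ℙB≈0)) (ℙ-nonNeg mA)

    ℙ-∩-null : ∀ {A B} → Measurable A → Measurable B → ℙ (∁ B) ≈ 0# → ℙ (A ∩ B) ≈ ℙ A
    ℙ-∩-null {A} {B} mA mB null = sym (trans (ℙ-split B mA mB)
      (trans (+-congˡ (ℙ-null (measurable-∩ mA (measurable-∁ mB)) (measurable-∁ mB) proj₂ null)) (+-identityʳ _)))

    ℙ-∁ : ∀ {A} → Measurable A → ℙ A ≈ 1# → ℙ (∁ A) ≈ 0#
    ℙ-∁ {A} mA ℙA≈1 = trans
      (solve 2 (λ a c → c := (a :+ c) :- a) refl (ℙ A) (ℙ (∁ A)))
      (trans (+-cong (trans (sym (ℙ-∪ mA (measurable-∁ mA) λ ω a ¬a → ¬a a)) (trans (sym (ℙ-cong (all , _) measurable-U)) ℙ-U)) (-‿cong ℙA≈1))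
        (-‿inverseʳ 1#))
      where
      all : ∀ {ω} → U ω → (A ∪ ∁ A) ω
      all {ω} _ with decide (A ω)
      ... | yes a = inj₁ a
      ... | no ¬a = inj₂ ¬a

    AlmostSure : Pred Ω 0ℓ → Set
    AlmostSure A = Measurable A ∧ ℙ (∁ A) ≈ 0#

    almostSure-∩ : ∀ {A B} → AlmostSure A → AlmostSure B → AlmostSure (A ∩ B)
    almostSure-∩ {A} {B} (mA , nullA) (mB , nullB) = mA∩B , trans (ℙ-split A m∁ mA) (trans (+-cong
      (ℙ-null (measurable-∩ m∁ mA) (measurable-∁ mB) (λ (¬ab , a) b → ¬ab (a , b)) nullB)
      (ℙ-null (measurable-∩ m∁ (measurable-∁ mA)) (measurable-∁ mA) proj₂ nullA)) (+-identityˡ 0#))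
      where
      mA∩B = measurable-∩ mA mB
      m∁   = measurable-∁ mA∩B

    almostSure-⋂ : ∀ {n} {A : Fin n → Pred Ω 0ℓ} → (∀ j → AlmostSure (A j)) → AlmostSure (⋂ (Fin n) A)
    almostSure-⋂ {zero}  as = measurable-≐ ((λ _ ()) , _) measurable-U , ℙ-empty λ ω ¬all → ¬all λ ()
    almostSure-⋂ {suc n} {A} as =
      let m , null = almostSure-∩ (as Fin.zero) (almostSure-⋂ (as ∘ Fin.suc))
          eq : (A Fin.zero ∩ ⋂ (Fin n) (A ∘ Fin.suc)) ≐ ⋂ (Fin (suc n)) A
          eq = (λ { (a , _) Fin.zero → a ; (_ , as) (Fin.suc j) → as j }) , λ as → as Fin.zero , λ j → as (Fin.suc j)
      in measurable-≐ eq m , trans (sym (ℙ-cong ((λ ¬a a → ¬a (proj₂ eq a)) , λ ¬a a → ¬a (proj₁ eq a)) (measurable-∁ m))) null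

    -- The set B is carried along so that positivity can be proved by cutting B into pieces.
    -- Coefficients may be negative, as is needed for differences.
    integral-on : Pred Ω 0ℓ → Simple → ℝ
    integral-on B []            = 0#
    integral-on B ((c , A) ∷ s) = c * ℙ (A ∩ B) + integral-on B s

    AllMeasurable : Simple → Set₁
    AllMeasurable = All (λ (_ , A) → Lift (lsuc 0ℓ) (Measurable A))

    integral-on-split : ∀ s {B} A → AllMeasurable s → Measurable B → Measurable A →
      integral-on B s ≈ integral-on (B ∩ A) s + integral-on (B ∩ ∁ A) s
    integral-on-split []            A []              mB mA = sym (+-identityˡ 0#)
    integral-on-split ((c , D) ∷ s) {B} A (lift mD ∷ ms) mB mA = trans
      (+-cong (*-congˡ (trans (ℙ-split A (measurable-∩ mD mB) mA) (+-cong (assoc A mA) (assoc (∁ A) (measurable-∁ mA)))))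
        (integral-on-split s A ms mB mA))
      (solve 5 (λ c x y u v → c :* (x :+ y) :+ (u :+ v) := (c :* x :+ u) :+ (c :* y :+ v)) refl
        c (ℙ (D ∩ (B ∩ A))) (ℙ (D ∩ (B ∩ ∁ A))) (integral-on (B ∩ A) s) (integral-on (B ∩ ∁ A) s))
      where
      assoc : ∀ A → Measurable A → ℙ ((D ∩ B) ∩ A) ≈ ℙ (D ∩ (B ∩ A))
      assoc A mA = ℙ-cong ((λ ((d , b) , a) → d , b , a) , λ (d , b , a) → (d , b) , a) (measurable-∩ (measurable-∩ mD mB) mA)

    -- The induction splits B along the first set of s, on whose two pieces
    -- the first term of s is constant.

    integral-on-nonNeg : ∀ s {B} c → AllMeasurable s → Measurable B →
      (∀ ω → B ω → 0# ≤ c + value s ω) → 0# ≤ c * ℙ B + integral-on B s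
    integral-on-nonNeg [] {B} c [] mB 0≤ with decide (∃ B)
    ... | yes (ω , b) = ≤-trans (*-nonNeg (≤-trans (0≤ ω b) (≤-reflexive (+-identityʳ c))) (ℙ-nonNeg mB)) (≤-reflexive (sym (+-identityʳ _)))
    ... | no ∄        = ≤-reflexive (sym (trans (+-identityʳ _) (trans (*-congˡ (ℙ-empty λ ω b → ∄ (ω , b))) (zeroʳ c))))
    integral-on-nonNeg ((d , A) ∷ s) {B} c (lift mA ∷ ms) mB 0≤ = ≤-trans
      (+-nonNeg
        (integral-on-nonNeg s (c + d) ms (measurable-∩ mB mA) λ ω (b , a) → ≤-trans (0≤ ω b)
          (≤-reflexive (trans (sym (+-assoc _ _ _)) (+-congʳ (+-congˡ (trans (*-congˡ (𝟙-yes A a)) (*-identityʳ d)))))))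
        (integral-on-nonNeg s c ms (measurable-∩ mB (measurable-∁ mA)) λ ω (b , ¬a) → ≤-trans (0≤ ω b)
          (≤-reflexive (+-congˡ (trans (+-congʳ (trans (*-congˡ (𝟙-no A ¬a)) (zeroʳ d))) (+-identityˡ _))))))
      (≤-reflexive (sym (trans
        (+-cong (*-congˡ (ℙ-split A mB mA)) (+-cong (*-congˡ (ℙ-cong ((λ (a , b) → b , a) , λ (b , a) → a , b) (measurable-∩ mA mB)))
          (integral-on-split s A ms mB mA)))
        (solve 6 (λ c d x y u v → c :* (x :+ y) :+ (d :* x :+ (u :+ v)) := ((c :+ d) :* x :+ u) :+ (c :* y :+ v)) refl
          c d (ℙ (B ∩ A)) (ℙ (B ∩ ∁ A)) (integral-on (B ∩ A) s) (integral-on (B ∩ ∁ A) s)))))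

    minus : Simple → Simple → Simple
    minus []            u = u
    minus ((c , A) ∷ s) u = (- c , A) ∷ minus s u

    value-minus : ∀ s u ω → value (minus s u) ω ≈ value u ω - value s ω
    value-minus []            u ω = sym (trans (+-congˡ (solve 0 (:- :0 := :0) refl)) (+-identityʳ _))
    value-minus ((c , A) ∷ s) u ω = trans (+-congˡ (value-minus s u ω))
      (solve 4 (λ c x u s → :- c :* x :+ (u :- s) := u :- (c :* x :+ s)) refl c (𝟙 A ω) (value u ω) (value s ω))

    AllMeasurable-minus : ∀ {s u} → AllMeasurable s → AllMeasurable u → AllMeasurable (minus s u)
    AllMeasurable-minus []       mu = mu
    AllMeasurable-minus (m ∷ ms) mu = m ∷ AllMeasurable-minus ms mu

    integral-on-minus : ∀ {B} → Measurable B → ℙ (∁ B) ≈ 0# → ∀ {s u} → AllMeasurable s → AllMeasurable u →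
      integral-on B (minus s u) ≈ integral u - integral s
    integral-on-minus mB null {[]} {[]} [] [] = solve 0 (:0 := :0 :- :0) refl
    integral-on-minus mB null {[]} {(c , A) ∷ u} [] (lift mA ∷ mu) = trans
      (+-cong (*-congˡ (ℙ-∩-null mA mB null)) (integral-on-minus mB null [] mu)) (sym (+-assoc _ _ _))
    integral-on-minus mB null {(c , A) ∷ s} {u} (lift mA ∷ ms) mu = trans
      (+-cong (*-congˡ (ℙ-∩-null mA mB null)) (integral-on-minus mB null ms mu))
      (solve 4 (λ c x u s → :- c :* x :+ (u :- s) := u :- (c :* x :+ s)) refl c (ℙ A) (integral u) (integral s))

    -- The difference u - s is nonnegative on B, and restricting to B changes no integral. An almost
    -- sure comparison is what the samples require, since they are at most θ only almost surely.
    integral-mono : ∀ {s u B} → AllMeasurable s → AllMeasurable u → Measurable B → ℙ (∁ B) ≈ 0# →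
      (∀ ω → B ω → value s ω ≤ value u ω) → integral s ≤ integral u
    integral-mono {s} {u} {B} ms mu mB null s≤u = 0≤-⇒≤ (≤-trans
      (integral-on-nonNeg (minus s u) 0# (AllMeasurable-minus ms mu) mB λ ω b →
        ≤-trans (≤⇒0≤- (s≤u ω b)) (≤-reflexive (sym (trans (+-identityˡ _) (value-minus s u ω)))))
      (≤-reflexive (trans (+-congʳ (zeroˡ _)) (trans (+-identityˡ _) (integral-on-minus mB null ms mu)))))

    -- c min(Y , n) is the simple function Σ_{t<n} c 1_{Y > t}.

    layers : ℝ → (ℕ → Pred Ω 0ℓ) → ℕ → Simple → Simple
    layers c A zero    s = s
    layers c A (suc n) s = (c , A n) ∷ layers c A n s

    value-layers : ∀ c A n s ω → value (layers c A n s) ω ≈ c * psum n (λ t → 𝟙 (A t) ω) + value s ω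
    value-layers c A zero    s ω = sym (trans (+-congʳ (zeroʳ c)) (+-identityˡ _))
    value-layers c A (suc n) s ω = trans (+-congˡ (value-layers c A n s ω))
      (trans (solve 4 (λ c x y s → c :* x :+ (c :* y :+ s) := c :* (y :+ x) :+ s) refl c (𝟙 (A n) ω) (psum n (λ t → 𝟙 (A t) ω)) (value s ω))
        (+-congʳ (*-congˡ (sym (psum-suc n (λ t → 𝟙 (A t) ω))))))

    integral-layers : ∀ c A n s → integral (layers c A n s) ≈ c * psum n (λ t → ℙ (A t)) + integral s
    integral-layers c A zero    s = sym (trans (+-congʳ (zeroʳ c)) (+-identityˡ _))
    integral-layers c A (suc n) s = trans (+-congˡ (integral-layers c A n s))
      (trans (solve 4 (λ c x y s → c :* x :+ (c :* y :+ s) := c :* (y :+ x) :+ s) refl c (ℙ (A n)) (psum n (λ t → ℙ (A t))) (integral s))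
        (+-congʳ (*-congˡ (sym (psum-suc n (λ t → ℙ (A t)))))))

    Admissible : Simple → Set₁
    Admissible s = All (λ (c , A) → (0# ≤ c) ∧ Measurable A) s

    layers-admissible : ∀ {c A s} → 0# ≤ c → (∀ t → Measurable (A t)) → ∀ n → Admissible s → Admissible (layers c A n s)
    layers-admissible 0≤c mA zero    as = as
    layers-admissible 0≤c mA (suc n) as = (0≤c , mA n) ∷ layers-admissible 0≤c mA n as

    admissible⇒measurable : ∀ {s} → Admissible s → AllMeasurable s
    admissible⇒measurable = All.map λ (_ , m) → lift m

    -- Without a supremum `𝔼⁺ Y` is ⊤⁺, which is not below itself.
    lowerSum-bound : ∀ {Y} → 𝔼⁺ Y <⁺ ⊤⁺ → ∃ λ e → IsUpperBound (LowerSum Y) e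
    lowerSum-bound {Y} finite with em {∃ (IsSupremum (LowerSum Y))}
    lowerSum-bound {Y} finite | yes (e , upper , _) = e , upper
    lowerSum-bound {Y} ()     | no _

    𝔼-attained : ∀ {Y e} → LowerSum ([_] ∘ Y) e → IsUpperBound (LowerSum ([_] ∘ Y)) e → 𝔼 Y ≈ e
    𝔼-attained {Y} {e} lower bound with em {∃ (IsSupremum (LowerSum ([_] ∘ Y)))}
    ... | yes (_ , upper , least) = antisym (least e bound) (upper e lower)
    ... | no ∄                    = contradiction (e , bound , λ b ub → ub e lower) ∄

    -- The layer cake formula at a single point, with `A t` in the role of the event Y > t and m in
    -- that of Y ω.
    psum-𝟙 : ∀ m n (A : ℕ → Pred Ω 0ℓ) ω → (∀ t → (A t ω → t ℕ.< m) ∧ (t ℕ.< m → A t ω)) →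
      psum n (λ t → 𝟙 (A t) ω) ≈ fromℕ (m ℕ.⊓ n)
    psum-𝟙 m zero    A ω A⇔< = sym (reflexive (≡.cong fromℕ (ℕₚ.⊓-zeroʳ m)))
    psum-𝟙 m (suc n) A ω A⇔< = trans (psum-suc n (λ t → 𝟙 (A t) ω)) (trans (+-congʳ (psum-𝟙 m n A ω A⇔<)) step)
      where
      step : fromℕ (m ℕ.⊓ n) + 𝟙 (A n) ω ≈ fromℕ (m ℕ.⊓ suc n)
      step with n ℕₚ.<? m
      ... | yes n<m = trans (+-cong (reflexive (≡.cong fromℕ (ℕₚ.m≥n⇒m⊓n≡n (ℕₚ.<⇒≤ n<m)))) (𝟙-yes (A n) (proj₂ (A⇔< n) n<m)))
            (trans (+-comm _ _) (reflexive (≡.cong fromℕ (≡.sym (ℕₚ.m≥n⇒m⊓n≡n n<m)))))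
      ... | no n≮m  = let m≤n = ℕₚ.≮⇒≥ n≮m in
            trans (+-cong (reflexive (≡.cong fromℕ (ℕₚ.m≤n⇒m⊓n≡m m≤n))) (𝟙-no (A n) (n≮m ∘ proj₁ (A⇔< n))))
              (trans (+-identityʳ _) (reflexive (≡.cong fromℕ (≡.sym (ℕₚ.m≤n⇒m⊓n≡m (ℕₚ.m≤n⇒m≤1+n m≤n))))))

    module Partition {S : Set} (countable : Countable S) where

      open Injection countable using (injective) renaming (to to code)

      IsPartition : Pred Ω 0ℓ → (S → Pred Ω 0ℓ) → Set
      IsPartition A B = (∀ q → Measurable (B q)) ∧ (∀ q r ω → B q ω → B r ω → q ≡ r) ∧ (⋃ S B ≐ A)

      -- The family is rearranged into a sequence, as countable additivity demands; numbers that are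
      -- not codes receive the empty event.
      Coded : (S → Pred Ω 0ℓ) → ℕ → Pred Ω 0ℓ
      Coded B n ω = ∃ λ q → code q ≡ n ∧ B q ω

      coded-yes : ∀ B q → B q ≐ Coded B (code q)
      coded-yes B q = (λ b → q , ≡.refl , b) , λ (r , eq , b) → ≡.subst (λ r → B r _) (injective eq) b

      coded-measurable : ∀ {B} → (∀ q → Measurable (B q)) → ∀ n → Measurable (Coded B n)
      coded-measurable {B} mB n with decide (∃ λ q → code q ≡ n)
      ... | yes (q , ≡.refl) = measurable-≐ (coded-yes B q) (mB q)
      ... | no ∄             = measurable-≐ ((λ ()) , λ (q , eq , _) → ∄ (q , eq)) measurable-∅

      -- These lists are repetition-free, so the partial sums of the coded series become finite sums
      -- of the kind that `IsSum` speaks of.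
      below : ℕ → List S
      below zero    = []
      below (suc n) with decide (∃ λ q → code q ≡ n)
      ... | yes (q , _) = q ∷ below n
      ... | no _        = below n

      below-< : ∀ n → All (λ q → code q ℕ.< n) (below n)
      below-< zero    = []
      below-< (suc n) with decide (∃ λ q → code q ≡ n)
      ... | yes (q , eq) = ℕₚ.≤-reflexive (≡.cong suc eq) ∷ All.map ℕₚ.m≤n⇒m≤1+n (below-< n)
      ... | no _         = All.map ℕₚ.m≤n⇒m≤1+n (below-< n)

      below-unique : ∀ n → Unique (below n)
      below-unique zero    = []
      below-unique (suc n) with decide (∃ λ q → code q ≡ n)
      ... | yes (q , eq) = All.map (λ r<n q≡r → ℕₚ.<-irrefl (≡.trans (≡.cong code (≡.sym q≡r)) eq) r<n) (below-< n) ∷ below-unique n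
      ... | no _         = below-unique n

      psum-coded : ∀ {B} → (∀ q → Measurable (B q)) → ∀ n → psum n (ℙ ∘ Coded B) ≈ sumOver (below n) (ℙ ∘ B)
      psum-coded mB zero = refl
      psum-coded {B} mB (suc n) = trans (psum-suc n (ℙ ∘ Coded B)) (trans (+-congʳ (psum-coded mB n)) step)
        where
        step : sumOver (below n) (ℙ ∘ B) + ℙ (Coded B n) ≈ sumOver (below (suc n)) (ℙ ∘ B)
        step with decide (∃ λ q → code q ≡ n)
        ... | yes (q , ≡.refl) = trans (+-comm _ _) (+-congʳ (sym (ℙ-cong (coded-yes B q) (mB q))))
        ... | no ∄             = trans (+-congˡ (ℙ-empty λ ω (q , eq , _) → ∄ (q , eq))) (+-identityʳ _)

      Among : List S → (S → Pred Ω 0ℓ) → Pred Ω 0ℓ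
      Among []       B = ∅
      Among (q ∷ qs) B = B q ∪ Among qs B

      among-∈ : ∀ qs {B ω} → Among qs B ω → ∃ λ q → (q ∈ qs) ∧ B q ω
      among-∈ (q ∷ qs) (inj₁ b) = q , here ≡.refl , b
      among-∈ (q ∷ qs) (inj₂ a) = let r , r∈ , b = among-∈ qs a in r , there r∈ , b

      among-measurable : ∀ {B} → (∀ q → Measurable (B q)) → ∀ qs → Measurable (Among qs B)
      among-measurable mB []       = measurable-∅
      among-measurable mB (q ∷ qs) = measurable-∪ (mB q) (among-measurable mB qs)

      ℙ-among : ∀ {A B} → IsPartition A B → ∀ qs → Unique qs → ℙ (Among qs B) ≈ sumOver qs (ℙ ∘ B)
      ℙ-among part []       _ = ℙ-∅
      ℙ-among part@(mB , disjoint , _) (q ∷ qs) (q∉ ∷ u) = trans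
        (ℙ-∪ (mB q) (among-measurable mB qs) λ ω b among → let r , r∈ , b′ = among-∈ qs among in
          All.lookup q∉ r∈ (disjoint q r ω b b′))
        (+-congˡ (ℙ-among part qs u))

      partition-measurable : ∀ {A B} → IsPartition A B → Measurable A
      partition-measurable {A} {B} (mB , disjoint , ⋃B≐A) = measurable-≐
        ((λ (_ , q , _ , b) → proj₁ ⋃B≐A (q , b)) , λ a → let q , b = proj₂ ⋃B≐A a in code q , q , ≡.refl , b)
        (measurable-⋃ (Coded B) (coded-measurable mB))

      -- Finite additivity and monotonicity give the upper bound; countable additivity along the
      -- codes gives minimality.
      ℙ-partition : ∀ {A B} → IsPartition A B → IsSum (ℙ ∘ B) (ℙ A)
      ℙ-partition {A} {B} part@(mB , disjoint , ⋃B≐A) =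
        (λ qs u → ≤-trans (≤-reflexive (sym (ℙ-among part qs u))) (ℙ-mono (among-measurable mB qs) (partition-measurable part)
          λ among → let q , _ , b = among-∈ qs among in proj₁ ⋃B≐A (q , b))) ,
        λ b bound → ≤-trans (≤-reflexive (sym (ℙ-cong
            ((λ (_ , q , _ , b) → proj₁ ⋃B≐A (q , b)) , λ a → let q , b = proj₂ ⋃B≐A a in code q , q , ≡.refl , b)
            (measurable-⋃ (Coded B) (coded-measurable mB)))))
          (Lim-≤ (λ n → ≤-trans (≤-reflexive (psum-coded mB n)) (bound (below n) (below-unique n)))
            (HasSeries⇒Lim {ℙ ∘ Coded B} (ℙ-additive (Coded B) (coded-measurable mB)
              λ { m n m≢n ω ((q , ≡.refl , b) , (r , ≡.refl , b′)) → m≢n (≡.cong code (disjoint q r ω b b′)) })))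

      ℙ-values : ∀ {A} (X : Ω → S) → Measurable A → (∀ q → Measurable (λ ω → X ω ≡ q)) →
        IsSum (λ q → ℙ (A ∩ λ ω → X ω ≡ q)) (ℙ A)
      ℙ-values X mA mX = ℙ-partition
        ( (λ q → measurable-∩ mA (mX q))
        , (λ q r ω (_ , eq) (_ , eq′) → ≡.trans (≡.sym eq) eq′)
        , (λ (q , a , _) → a) , λ a → _ , a , ≡.refl )

-- Return times and the Markov property

module Chains (em : ExcludedMiddle (lsuc 0ℓ)) (R : CompleteOrderedField) where

  open CompleteOrderedField R
  open Theory em R
  open OrderedField em R
  open Sums em R
  open TransitionMatrices em R
  open Probability em R
  open SupremumNonStrict _≤_ using (_≤⁺_; [_]; _≤⊤⁺)
  open SupremumStrict ℕ._<_ using ([_]; [_]<⊤⁺) renaming (_<⁺_ to _<∞_)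

  module Chain {S : Set} (countable : Countable S) {P : S → S → ℝ} (isTM : IsTransitionMatrix P) (chain : MarkovChain P) where

    open Powers P isTM
    open MarkovChain chain
    open Measurability space

    -- This form of the event T_i > t visibly depends on X_1, ..., X_t alone and can be built up one
    -- time at a time, whereas `T` is chosen by excluded middle.
    NoReturn : S → ℕ → Pred Ω 0ℓ
    NoReturn i t ω = ∀ m → 1 ℕ.≤ m → m ℕ.≤ t → X m ω ≢ i

    noReturn-suc : ∀ i t → (NoReturn i t ∩ ∁ (λ ω → X (suc t) ω ≡ i)) ≐ NoReturn i (suc t)
    noReturn-suc i t =
      (λ { {ω} (none , X≢i) m 1≤m m≤1+t → [ (λ m<1+t → none m 1≤m (ℕ.s≤s⁻¹ m<1+t)) , (λ { ≡.refl → X≢i }) ]′ (ℕₚ.m≤n⇒m<n∨m≡n m≤1+t) }) ,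
      λ none → (λ m 1≤m m≤t → none m 1≤m (ℕₚ.m≤n⇒m≤1+n m≤t)) , none (suc t) (ℕ.s≤s ℕ.z≤n) ℕₚ.≤-refl

    noReturn-measurable : ∀ i t → Measurable (NoReturn i t)
    noReturn-measurable i zero    = measurable-≐ ((λ { _ m 1≤m m≤0 → contradiction (ℕₚ.≤-trans 1≤m m≤0) λ () }) , _) measurable-U
    noReturn-measurable i (suc t) = measurable-≐ (noReturn-suc i t)
      (measurable-∩ (noReturn-measurable i t) (measurable-∁ (X-measurable (suc t) i)))

    -- Scanning the times in order turns any visit into a first one; hence a path whose return time
    -- is ⊤⁺ has no visits at positive times.
    search : ∀ i n ω → NoReturn i n ω ⊎ ∃ (IsReturnTime i ω)
    search i zero    ω = inj₁ λ { m 1≤m m≤0 → contradiction (ℕₚ.≤-trans 1≤m m≤0) λ () }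
    search i (suc n) ω with search i n ω | decide (X (suc n) ω ≡ i)
    ... | inj₂ found | _       = inj₂ found
    ... | inj₁ none  | yes X≡i = inj₂ (suc n , ℕ.s≤s ℕ.z≤n , X≡i , λ m 1≤m m<1+n → none m 1≤m (ℕ.s≤s⁻¹ m<1+n))
    ... | inj₁ none  | no X≢i  = inj₁ (proj₁ (noReturn-suc i n) (none , X≢i))

    T>-noReturn : ∀ i t → (T[ i ]> t) ≐ NoReturn i t
    T>-noReturn i t = (λ {ω} → to ω) , λ {ω} → from ω
      where
      to : ∀ ω → (T[ i ]> t) ω → NoReturn i t ω
      to ω t<T with decide (∃ (IsReturnTime i ω)) | search i t ω
      to ω t<T     | no ∄                     | inj₂ found = contradiction found ∄
      to ω t<T     | no ∄                     | inj₁ none  = none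
      to ω [ t<n ] | yes (n , _ , _ , before) | _          = λ m 1≤m m≤t → before m 1≤m (ℕₚ.≤-<-trans m≤t t<n)
      from : ∀ ω → NoReturn i t ω → (T[ i ]> t) ω
      from ω none with decide (∃ (IsReturnTime i ω))
      ... | no _                    = [ t ]<⊤⁺
      ... | yes (n , 1≤n , X≡i , _) = [ ℕₚ.≰⇒> (λ n≤t → none n 1≤n n≤t X≡i) ]

    T>-measurable : ∀ i t → Measurable (T[ i ]> t)
    T>-measurable i t = measurable-≐ (≐-sym (T>-noReturn i t)) (noReturn-measurable i t)

    update : (ℕ → S) → ℕ → S → ℕ → S
    update x s z r with r ℕₚ.≟ s
    ... | yes _ = z
    ... | no _  = x r

    update-≡ : ∀ x s z → update x s z s ≡ z
    update-≡ x s z with s ℕₚ.≟ s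
    ... | yes _  = ≡.refl
    ... | no s≢s = contradiction ≡.refl s≢s

    update-< : ∀ x s z {r} → r ℕ.< s → update x s z r ≡ x r
    update-< x s z {r} r<s with r ℕₚ.≟ s
    ... | yes r≡s = contradiction r<s (ℕₚ.<-irrefl r≡s)
    ... | no _    = ≡.refl

    module Started (i : S) where

      open ProbabilityMeasure (law i) using (ℙ; ℙ-cong; ℙ-nonNeg; ℙ-U; value)
      open Measure (law i)
      open Measure.Partition (law i) countable using (ℙ-values)

      -- With the strict inequality `Prefix x 0` is the whole space, while `Prefix x (suc t)` is
      -- `History x t`.
      Prefix : (ℕ → S) → ℕ → Pred Ω 0ℓ
      Prefix x s ω = ∀ r → r ℕ.< s → X r ω ≡ x r

      prefix-suc : ∀ x s z → (Prefix x s ∩ λ ω → X s ω ≡ z) ≐ Prefix (update x s z) (suc s)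
      prefix-suc x s z =
        (λ (prefix , Xs≡z) r r<1+s → [ (λ r<s → ≡.trans (prefix r r<s) (≡.sym (update-< x s z r<s)))
                                     , (λ { ≡.refl → ≡.trans Xs≡z (≡.sym (update-≡ x s z)) }) ]′ (ℕₚ.m<1+n⇒m<n∨m≡n r<1+s)) ,
        λ prefix → (λ r r<s → ≡.trans (prefix r (ℕₚ.m<n⇒m<1+n r<s)) (update-< x s z r<s)) , ≡.trans (prefix s ℕₚ.≤-refl) (update-≡ x s z)

      prefix-measurable : ∀ x s → Measurable (Prefix x s)
      prefix-measurable x zero    = measurable-≐ ((λ _ _ ()) , _) measurable-U
      prefix-measurable x (suc s) = measurable-≐
        ((λ (prefix , Xs≡) r r<1+s → [ prefix r , (λ { ≡.refl → Xs≡ }) ]′ (ℕₚ.m<1+n⇒m<n∨m≡n r<1+s))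
        , λ prefix → (λ r r<s → prefix r (ℕₚ.m<n⇒m<1+n r<s)) , prefix s ℕₚ.≤-refl)
        (measurable-∩ (prefix-measurable x s) (X-measurable s (x s)))

      DeterminedBy : ℕ → Pred Ω 0ℓ → Set
      DeterminedBy t E = ∀ ω ω′ → (∀ s → s ℕ.≤ t → X s ω ≡ X s ω′) → E ω → E ω′

      -- The Markov property is given for complete histories only.  It passes
      -- from longer prefixes to shorter ones by summing over the last value.

      markov-event : ∀ t m y {E} → Measurable E → DeterminedBy t E → (∀ ω → E ω → X t ω ≡ m) →
        ℙ (E ∩ λ ω → X (suc t) ω ≡ y) ≈ P m y * ℙ E
      markov-event t m y {E} mE determined X≡m = trans
        (ℙ-cong ((λ (e , eq) → (e , λ _ ()) , eq) , λ ((e , _) , eq) → e , eq) (measurable-∩ mE mY))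
        -- At length 0 the path is arbitrary; the constant path at m is one that is available.
        (trans (go (suc t) 0 (ℕₚ.+-identityʳ _) (λ _ → m)) (*-congˡ (ℙ-cong (proj₁ , λ e → e , λ _ ()) (mEx (λ _ → m) 0))))
        where
        Y : Pred Ω 0ℓ
        Y ω = X (suc t) ω ≡ y
        mY : Measurable Y
        mY = X-measurable (suc t) y
        mEx : ∀ x s → Measurable (E ∩ Prefix x s)
        mEx x s = measurable-∩ mE (prefix-measurable x s)
        E≐H : ∀ {x ω₀} → Prefix x (suc t) ω₀ → E ω₀ → (E ∩ Prefix x (suc t)) ≐ History x t
        E≐H {ω₀ = ω₀} prefix₀ e₀ = (λ (_ , prefix) s s≤t → prefix s (ℕ.s≤s s≤t)) ,
          λ {ω} hist → determined ω₀ ω (λ s s≤t → ≡.trans (prefix₀ s (ℕ.s≤s s≤t)) (≡.sym (hist s s≤t))) e₀ ,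
                       λ s s<1+t → hist s (ℕ.s≤s⁻¹ s<1+t)
        -- A complete prefix that meets E lies inside it, as E is determined by the times up to t,
        -- so `markov` applies. If the history has probability 0, conditioning on it is excluded,
        -- but then both sides vanish.
        full : ∀ x → ℙ ((E ∩ Prefix x (suc t)) ∩ Y) ≈ P m y * ℙ (E ∩ Prefix x (suc t))
        full x with decide (∃ (E ∩ Prefix x (suc t)))
        ... | no ∄ = trans (ℙ-empty λ ω (e , _) → ∄ (ω , e)) (sym (trans (*-congˡ (ℙ-empty λ ω e → ∄ (ω , e))) (zeroʳ _)))
        ... | yes (ω₀ , e₀ , prefix₀) with decide (ℙ (History x t) ≈ 0#)
        ...   | yes null = trans (ℙ-null (measurable-∩ (mEx x (suc t)) mY) (mEx x (suc t)) proj₁ null′) (sym (trans (*-congˡ null′) (zeroʳ _)))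
          where
          null′ : ℙ (E ∩ Prefix x (suc t)) ≈ 0#
          null′ = trans (ℙ-cong (E≐H prefix₀ e₀) (mEx x (suc t))) null
        ...   | no ℙ≉0 = begin
          ℙ ((E ∩ Prefix x (suc t)) ∩ Y)
            ≈⟨ ℙ-cong ((λ (e , eq) → eq , proj₁ (E≐H prefix₀ e₀) e) , λ (eq , hist) → proj₂ (E≐H prefix₀ e₀) hist , eq) (measurable-∩ (mEx x (suc t)) mY) ⟩
          ℙ (Y ∩ History x t)
            ≈⟨ *-identityʳ _ ⟨
          ℙ (Y ∩ History x t) * 1#
            ≈⟨ *-congˡ (trans (*-comm _ _) (⁻¹-inverse _ ℙ≉0)) ⟨
          ℙ (Y ∩ History x t) * (ℙ (History x t) ⁻¹ * ℙ (History x t))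
            ≈⟨ *-assoc _ _ _ ⟨
          ℙ (Y ∩ History x t) * ℙ (History x t) ⁻¹ * ℙ (History x t)
            ≈⟨ *-congʳ (markov i x t y ℙ≉0) ⟩
          P (x t) y * ℙ (History x t)
            ≈⟨ *-cong (reflexive (≡.cong (λ q → P q y) (≡.trans (≡.sym (prefix₀ t ℕₚ.≤-refl)) (X≡m ω₀ e₀)))) (sym (ℙ-cong (E≐H prefix₀ e₀) (mEx x (suc t)))) ⟩
          P m y * ℙ (E ∩ Prefix x (suc t)) ∎
          where
          open import Relation.Binary.Reasoning.Setoid setoid
        go : ∀ d s → d ℕ.+ s ≡ suc t → ∀ x → ℙ ((E ∩ Prefix x s) ∩ Y) ≈ P m y * ℙ (E ∩ Prefix x s)
        go zero    s ≡.refl x = full x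
        go (suc d) s eq     x = IsSum-unique
          (ℙ-values (X s) (measurable-∩ (mEx x s) mY) (X-measurable s))
          (IsSum-cong
            (λ z → trans (*-congˡ (ℙ-cong (extend z) (measurable-∩ (mEx x s) (X-measurable s z))))
              (trans (sym (go d (suc s) (≡.trans (ℕₚ.+-suc d s) eq) (update x s z)))
                (ℙ-cong ((λ (e , eq) → let (e , Xs) = proj₂ (extend z) e in (e , eq) , Xs) , λ ((e , eq) , Xs) → proj₁ (extend z) (e , Xs) , eq)
                  (measurable-∩ (mEx (update x s z) (suc s)) mY))))
            refl (IsSum-* (P-nonNeg m y) (ℙ-values (X s) (mEx x s) (X-measurable s))))
          where
          extend : ∀ z → ((E ∩ Prefix x s) ∩ λ ω → X s ω ≡ z) ≐ (E ∩ Prefix (update x s z) (suc s))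
          extend z = (λ ((e , prefix) , Xs) → e , proj₁ (prefix-suc x s z) (prefix , Xs)) ,
            λ (e , prefix) → let prefix′ , Xs = proj₂ (prefix-suc x s z) prefix in (e , prefix′) , Xs

      At : ℕ → S → Pred Ω 0ℓ
      At t q ω = X t ω ≡ q

      a : ℕ → S → ℝ
      a t q = ℙ (At t q ∩ (T[ i ]> t))

      p : ℕ → ℝ
      p t = ℙ (T[ i ]> t)

      a-measurable : ∀ t q → Measurable (At t q ∩ (T[ i ]> t))
      a-measurable t q = measurable-∩ (X-measurable t q) (T>-measurable i t)

      T>0 : ∀ ω → (T[ i ]> 0) ω
      T>0 ω = proj₂ (T>-noReturn i 0) λ { m 1≤m m≤0 → contradiction (ℕₚ.≤-trans 1≤m m≤0) λ () }

      p-0 : p 0 ≈ 1#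
      p-0 = trans (ℙ-cong (_ , λ {ω} _ → T>0 ω) (T>-measurable i 0)) (ℙ-U)

      -- Arriving at q ≠ i is not a return, so given X_{t+1} = q the event T_i > t + 1 reduces to
      -- T_i > t, which belongs to the past.
      T>-suc : ∀ {t q} → q ≢ i → ∀ m → ((At (suc t) q ∩ (T[ i ]> suc t)) ∩ At t m) ≐ ((At t m ∩ (T[ i ]> t)) ∩ At (suc t) q)
      T>-suc {t} q≢i m =
        (λ ((Xq , T>) , Xm) → (Xm , proj₂ (T>-noReturn i t) (proj₁ (proj₂ (noReturn-suc i t) (proj₁ (T>-noReturn i (suc t)) T>)))) , Xq) ,
        λ ((Xm , T>) , Xq) → (Xq , proj₂ (T>-noReturn i (suc t)) (proj₁ (noReturn-suc i t)
          (proj₁ (T>-noReturn i t) T> , λ X≡i → q≢i (≡.trans (≡.sym Xq) X≡i)))) , Xm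

      a-suc : ∀ t {q} → q ≢ i → IsSum (λ m → a t m * P m q) (a (suc t) q)
      a-suc t {q} q≢i = IsSum-cong
        (λ m → trans (ℙ-cong (T>-suc q≢i m) (measurable-∩ (a-measurable (suc t) q) (X-measurable t m)))
          (trans (markov-event t m q (a-measurable t m) (determined m) (λ _ → proj₁)) (*-comm _ _)))
        refl (ℙ-values (X t) (a-measurable (suc t) q) (X-measurable t))
        where
        determined : ∀ m → DeterminedBy t (At t m ∩ (T[ i ]> t))
        determined m ω ω′ agree (Xm , T>) = ≡.trans (≡.sym (agree t ℕₚ.≤-refl)) Xm ,
          proj₂ (T>-noReturn i t) λ s 1≤s s≤t X≡i → proj₁ (T>-noReturn i t) T> s 1≤s s≤t (≡.trans (agree s s≤t) X≡i)

      -- The value of these layers is min(T_i, n).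
      layers-T : ∀ n ω → [ value (layers 1# (T[ i ]>_) n []) ω ] ≤⁺ fromℕ⁺ (T i ω)
      layers-T n ω = go (T i ω) ≡.refl
        where
        go : ∀ τ → T i ω ≡ τ → [ value (layers 1# (T[ i ]>_) n []) ω ] ≤⁺ fromℕ⁺ τ
        go ⊤⁺    T≡τ = _ ≤⊤⁺
        go [ m ] T≡τ = [ ≤-trans
          (≤-reflexive (trans (value-layers 1# (T[ i ]>_) n [] ω) (trans (+-identityʳ _) (trans (*-identityˡ _)
            (psum-𝟙 m n (T[ i ]>_) ω λ t → (λ T> → unwrap (≡.subst ([ t ] <∞_) T≡τ T>)) , λ t<m → ≡.subst ([ t ] <∞_) (≡.sym T≡τ) [ t<m ])))))
          (fromℕ-mono-≤ (ℕₚ.m⊓n≤m m n)) ]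
          where
          unwrap : ∀ {t} → [ t ] <∞ [ m ] → t ℕ.< m
          unwrap [ t<m ] = t<m

      killedChain : PositiveRecurrent → KilledChain i
      killedChain recurrent = record
        { a        = a
        ; p        = p
        ; C        = proj₁ (lowerSum-bound (recurrent i))
        ; a-nonNeg = λ t q → ℙ-nonNeg (a-measurable t q)
        ; a-start  = trans (ℙ-cong (proj₁ , λ {ω} X≡i → X≡i , T>0 ω) (a-measurable 0 i)) (start i)
        ; a-0-≢    = λ {q} q≢i → ℙ-null (a-measurable 0 q) (measurable-∁ (X-measurable 0 i))
                       (λ (Xq , _) X≡i → q≢i (≡.trans (≡.sym Xq) X≡i)) (ℙ-∁ (X-measurable 0 i) (start i))
        ; a-killed = λ t → ℙ-empty λ ω (X≡i , T>) → proj₁ (T>-noReturn i (suc t)) T> (suc t) (ℕ.s≤s ℕ.z≤n) ℕₚ.≤-refl X≡i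
        ; a-suc    = a-suc
        ; a-mass   = λ t → IsSum-cong
                       (λ q → ℙ-cong ((λ (T> , Xq) → Xq , T>) , λ (Xq , T>) → T> , Xq) (measurable-∩ (T>-measurable i t) (X-measurable t q)))
                       refl (ℙ-values (X t) (T>-measurable i t) (X-measurable t))
        -- The integral of min(T_i, n) is Σ_{t<n} p_t, so this is one of the lower sums whose
        -- supremum is 𝔼_i[T_i].
        ; p-bound  = λ n → proj₂ (lowerSum-bound (recurrent i)) (psum n p)
                       ( layers 1# (T[ i ]>_) n [] , layers-admissible 0≤1 (T>-measurable i) n [] , layers-T n
                       , sym (trans (integral-layers 1# (T[ i ]>_) n []) (trans (+-identityʳ _) (*-identityˡ _))) )
        }

-- The expectation of the sample mean

module Estimator (em : ExcludedMiddle (lsuc 0ℓ)) (R : CompleteOrderedField) where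

  open CompleteOrderedField R
  open Theory em R
  open IntegerSolver commutativeRing
  open OrderedField em R
  open Sums em R
  open TransitionMatrices em R
  open Probability em R
  open Chains em R
  open MonoidSum +-monoid using () renaming (sum-cong-≋ to sum-cong)
  open SupremumNonStrict _≤_ using ([_]; [≤]-injective)
  open SupremumStrict ℕ._<_ using ([_]; [_]<⊤⁺) renaming (_<⁺_ to _<∞_)

  sum-mono : ∀ {n} {f g : Fin n → ℝ} → (∀ j → f j ≤ g j) → sum f ≤ sum g
  sum-mono {zero}  f≤g = ≤-refl
  sum-mono {suc n} f≤g = +-mono-≤ (f≤g Fin.zero) (sum-mono (f≤g ∘ Fin.suc))

  sum-const : ∀ n x → sum {n} (λ _ → x) ≈ fromℕ n * x
  sum-const zero    x = sym (zeroˡ x)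
  sum-const (suc n) x = trans (+-congˡ (sum-const n x)) (solve 2 (λ n x → x :+ n :* x := (:1 :+ n) :* x) refl (fromℕ n) x)

  module SampleMean {S : Set} (countable : Countable S) {P : S → S → ℝ} (isTM : IsTransitionMatrix P) (chain : MarkovChain P)
    (i : S) (θ N : ℕ) (samples : MarkovChain.Samples chain i θ (suc N)) where

    open MarkovChain chain using (law; T; T[_]>_; min; module Samples)
    open Chain countable isTM chain
    open Started i using (p)
    open Samples samples
    open MeasurableSpace sampleSpace using (measurable-≐; measurable-∁; measurable-⋃) renaming (Ω to Ω′; Measurable to Measurable′)
    open ProbabilityMeasure sampleLaw using (LowerSum; Simple; value; integral; 𝔼) renaming (ℙ to ℙ′; ℙ-cong to ℙ′-cong)
    open Measurability sampleSpace
    open Measure sampleLaw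

    Above : Fin (suc N) → ℕ → Pred Ω′ 0ℓ
    Above j t ω = t ℕ.< Y j ω

    above-measurable : ∀ j t → Measurable′ (Above j t)
    above-measurable j t = measurable-≐
      ((λ (k , Y≡) → ≡.subst (t ℕ.<_) (≡.sym Y≡) (ℕₚ.m≤m+n (suc t) k)) ,
       λ t<Y → let k , eq = ℕₚ.m≤n⇒∃[o]m+o≡n t<Y in k , ≡.sym eq)
      (measurable-⋃ (λ k ω → Y j ω ≡ suc t ℕ.+ k) λ k → Y-measurable j (suc t ℕ.+ k))

    -- Truncation at θ does not affect comparisons with t < θ.
    ℙ-above : ∀ j {t} → t ℕ.< θ → ℙ′ (Above j t) ≈ p t
    ℙ-above j {t} t<θ = trans (distribution j (t ℕ.<_))
      (sym (ProbabilityMeasure.ℙ-cong (law i) ((λ {ω} → to (T i ω)) , λ {ω} → from (T i ω)) (T>-measurable i t)))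
      where
      to : ∀ τ → [ t ] <∞ τ → t ℕ.< min τ θ
      to [ n ] [ t<n ]    = ℕₚ.⊓-pres-m< t<n t<θ
      to ⊤⁺    [ _ ]<⊤⁺ = t<θ
      from : ∀ τ → t ℕ.< min τ θ → [ t ] <∞ τ
      from [ n ] t<n⊓θ = [ ℕₚ.<-≤-trans t<n⊓θ (ℕₚ.m⊓n≤m n θ) ]
      from ⊤⁺    t<θ   = [ t ]<⊤⁺

    ℙ-above-θ : ∀ j → ℙ′ (Above j θ) ≈ 0#
    ℙ-above-θ j = trans (distribution j (θ ℕ.<_)) (Measure.ℙ-empty (law i) λ ω → none (T i ω))
      where
      none : ∀ τ → ¬ θ ℕ.< min τ θ
      none [ n ] θ< = ℕₚ.<-irrefl ≡.refl (ℕₚ.<-≤-trans θ< (ℕₚ.m⊓n≤n n θ))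
      none ⊤⁺    θ< = ℕₚ.<-irrefl ≡.refl θ<

    -- The copies share only the law of min(T_i, θ), so individual outcomes may exceed θ, but only
    -- on a null set.
    Bounded : Pred Ω′ 0ℓ
    Bounded = ⋂ (Fin (suc N)) λ j ω → Y j ω ℕ.≤ θ

    bounded-almostSure : AlmostSure Bounded
    bounded-almostSure = almostSure-⋂ λ j →
      measurable-≐ (ℕₚ.≮⇒≥ , ℕₚ.≤⇒≯) (measurable-∁ (above-measurable j θ)) ,
      trans (sym (ℙ′-cong (ℕₚ.<⇒≱ , ℕₚ.≰⇒>) (above-measurable j θ))) (ℙ-above-θ j)

    weight : ℝ
    weight = fromℕ (suc N) ⁻¹

    weight-nonNeg : 0# ≤ weight
    weight-nonNeg = ⁻¹-nonNeg (fromℕ-nonNeg (suc N))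

    -- The number n of families varies in the recursion, while `weight` stays 1 / (N + 1). Applied
    -- to `Above`, this is the mean of the min(Y_j, θ).
    truncatedMean : ∀ {n} → (Fin n → ℕ → Pred Ω′ 0ℓ) → Simple
    truncatedMean {zero}  A = []
    truncatedMean {suc n} A = layers weight (A Fin.zero) θ (truncatedMean (A ∘ Fin.suc))

    value-truncatedMean : ∀ {n} (A : Fin n → ℕ → Pred Ω′ 0ℓ) ω →
      value (truncatedMean A) ω ≈ weight * sum (λ j → psum θ (λ t → 𝟙 (A j t) ω))
    value-truncatedMean {zero}  A ω = sym (zeroʳ _)
    value-truncatedMean {suc n} A ω = trans (value-layers weight (A Fin.zero) θ _ ω)
      (trans (+-congˡ (value-truncatedMean (A ∘ Fin.suc) ω)) (sym (distribˡ _ _ _)))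

    integral-truncatedMean : ∀ {n} (A : Fin n → ℕ → Pred Ω′ 0ℓ) →
      integral (truncatedMean A) ≈ weight * sum (λ j → psum θ (λ t → ℙ′ (A j t)))
    integral-truncatedMean {zero}  A = sym (zeroʳ _)
    integral-truncatedMean {suc n} A = trans (integral-layers weight (A Fin.zero) θ _)
      (trans (+-congˡ (integral-truncatedMean (A ∘ Fin.suc))) (sym (distribˡ _ _ _)))

    truncatedMean-admissible : ∀ {n} {A : Fin n → ℕ → Pred Ω′ 0ℓ} → (∀ j t → Measurable′ (A j t)) → Admissible (truncatedMean A)
    truncatedMean-admissible {zero}  mA = []
    truncatedMean-admissible {suc n} mA =
      layers-admissible weight-nonNeg (mA Fin.zero) θ (truncatedMean-admissible (mA ∘ Fin.suc))

    value-above : ∀ ω → value (truncatedMean Above) ω ≈ weight * sum (λ j → fromℕ (Y j ω ℕ.⊓ θ))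
    value-above ω = trans (value-truncatedMean Above ω)
      (*-congˡ (sum-cong λ j → psum-𝟙 (Y j ω) θ (Above j) ω λ t → (λ t<Y → t<Y) , λ t<Y → t<Y))

    integral-above : integral (truncatedMean Above) ≈ psum θ p
    integral-above = begin
      integral (truncatedMean Above)
        ≈⟨ integral-truncatedMean Above ⟩
      weight * sum (λ j → psum θ (λ t → ℙ′ (Above j t)))
        ≈⟨ *-congˡ (sum-cong λ j → psum-cong θ {λ t → ℙ′ (Above j t)} {p} λ t t<θ → ℙ-above j t<θ) ⟩
      weight * sum {suc N} (λ _ → psum θ p)
        ≈⟨ *-congˡ (sum-const (suc N) _) ⟩
      weight * (fromℕ (suc N) * psum θ p)
        ≈⟨ solve 3 (λ w n x → w :* (n :* x) := (n :* w) :* x) refl weight (fromℕ (suc N)) (psum θ p) ⟩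
      fromℕ (suc N) * weight * psum θ p
        ≈⟨ *-congʳ (⁻¹-inverse _ (fromℕ-suc≉0 N)) ⟩
      1# * psum θ p
        ≈⟨ *-identityˡ _ ⟩
      psum θ p ∎
      where open import Relation.Binary.Reasoning.Setoid setoid

    -- The supremum defining the integral is attained: the mean of the min(Y_j, θ) lies below T̂
    -- everywhere and equals it almost surely, so no simple function below T̂ has a larger integral.
    𝔼[T̂]≈ : 𝔼[T̂] ≈ psum θ p
    𝔼[T̂]≈ = 𝔼-attained
      ( truncatedMean Above , truncatedMean-admissible above-measurable
      , (λ ω → [ ≤-trans (≤-reflexive (trans (value-above ω) (*-comm _ _)))
                   (*-monoˡ-≤ weight-nonNeg (sum-mono λ j → fromℕ-mono-≤ (ℕₚ.m⊓n≤m (Y j ω) θ))) ])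
      , sym integral-above )
      λ r (s , admissible , s≤T̂ , r≈) → ≤-trans (≤-reflexive r≈) (≤-trans
        (integral-mono (admissible⇒measurable admissible) (admissible⇒measurable (truncatedMean-admissible above-measurable))
          (proj₁ bounded-almostSure) (proj₂ bounded-almostSure)
          λ ω bounded → ≤-trans ([≤]-injective (s≤T̂ ω)) (≤-reflexive (sym (trans (value-above ω)
            (trans (*-comm _ _) (*-congʳ (sum-cong λ j → reflexive (≡.cong fromℕ (ℕₚ.m≤n⇒m⊓n≡m (bounded j))))))))))
        (≤-reflexive integral-above))

  -- The bias formula

  module Bias {S : Set} (countable : Countable S) {P : S → S → ℝ} (isTM : IsTransitionMatrix P) (chain : MarkovChain P) where

    open MarkovChain chain
    open Chain countable isTM chain
    open Powers P isTM

    module _ (recurrent : PositiveRecurrent) (π : S → ℝ) (i : S) (converges : ∀ j → Convergent (fundamentalTerm P π j i)) where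

      open Started i
      open KilledChain (killedChain recurrent) using (a-nonNeg; a-killed; a-mass)

      h∞ : S → ℝ
      h∞ q = fundamental P π i i - fundamental P π q i

      hasSeries : ∀ j → HasSeries (fundamentalTerm P π j i) (fundamental P π j i)
      hasSeries j = series-correct {fundamentalTerm P π j i} (converges j)

      power⟶π : ∀ j → Lim (λ t → power P t j i) (π i)
      power⟶π j = Lim-cong (λ t → solve 2 (λ x y → (x :- y) :+ y := x) refl (power P t j i) (π i)) (+-identityˡ _)
        (Lim-+ (HasSeries⇒Lim0 {fundamentalTerm P π j i} (hasSeries j)) (Lim-const (π i)))

      -- The two series for Z_ii and Z_ji subtract the same π_i at each time, so it cancels in the
      -- difference of their partial sums.
      h⟶h∞ : ∀ j → Lim (λ n → psum n (λ t → power P t i i) - psum n (λ t → power P t j i)) (h∞ j)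
      h⟶h∞ j = Lim-cong
        (λ n → trans (sym (psum-- n (fundamentalTerm P π i i) (fundamentalTerm P π j i)))
          (trans (psum-cong n λ t _ → solve 3 (λ x y c → (x :- c) :- (y :- c) := x :- y) refl (power P t i i) (power P t j i) (π i))
            (psum-- n (λ t → power P t i i) (λ t → power P t j i))))
        refl
        (Lim-+ (HasSeries⇒Lim {fundamentalTerm P π i i} (hasSeries i))
          (Lim-neg (HasSeries⇒Lim {fundamentalTerm P π j i} (hasSeries j))))

      open Excursion (killedChain recurrent) {π i} power⟶π {h∞} h⟶h∞ using (excursion-identity; h-nonNeg)

      module _ (t : ℕ) where

        θ : ℕ
        θ = suc t

        -- At q = i the right side vanishes by the indicator and the left one because the chain has
        -- been killed there, so the excursion identity over all states fits the sum over q ≠ i.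
        Γ-term≈ : ∀ q → p θ ⁻¹ * (a θ q * h∞ q) ≈ Γ-term π i θ q
        Γ-term≈ q with decide (q ≡ i)
        ... | yes ≡.refl = trans (trans (*-congˡ (trans (*-congʳ (a-killed t)) (zeroˡ _))) (zeroʳ _))
              (sym (trans (*-congʳ (𝟙-no (_≢ i) λ i≢i → i≢i ≡.refl)) (zeroˡ _)))
        ... | no q≢i     = trans (solve 3 (λ i a h → i :* (a :* h) := (a :* i) :* h) refl (p θ ⁻¹) (a θ q) (h∞ q))
              (sym (trans (*-congʳ (𝟙-yes (_≢ i) q≢i)) (*-identityˡ _)))

        excursion : ℝ
        excursion = 1# - π i * psum θ p

        p-nonNeg : 0# ≤ p θ
        p-nonNeg = IsSum-nonNeg (a-mass θ)

        Γ-sum : IsSum (Γ-term π i θ) (p θ ⁻¹ * excursion)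
        Γ-sum = IsSum-cong Γ-term≈ refl (IsSum-* (⁻¹-nonNeg p-nonNeg) (excursion-identity t))

        Γ-term-nonNeg : NonNeg (Γ-term π i θ)
        Γ-term-nonNeg q = ≤-trans
          (*-nonNeg (⁻¹-nonNeg p-nonNeg) (*-nonNeg (a-nonNeg θ q) (Lim-≥ (λ n → h-nonNeg n q) (h⟶h∞ q))))
          (≤-reflexive (Γ-term≈ q))

        Γ-summable : Summable (Γ-term π i θ)
        Γ-summable = _ , IsSum⇒HasSum Γ-term-nonNeg Γ-sum

        p*Γ : p θ * Γ π i θ ≈ excursion
        p*Γ with decide (p θ ≈ 0#)
        ... | no p≉0  = trans (*-congˡ (IsSum-unique (IsSum-∑ Γ-term-nonNeg Γ-sum) Γ-sum))
              (trans (sym (*-assoc _ _ _)) (trans (*-congʳ (⁻¹-inverse _ p≉0)) (*-identityˡ _)))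
        -- If p_θ = 0, the left side vanishes whatever Γ is. All the masses a_θ(q) vanish too, so
        -- the excursion identity sums zeros and its value `excursion` is 0.
        ... | yes p≈0 = trans (trans (*-congʳ p≈0) (zeroˡ _))
              (IsSum-unique (IsSum-zero λ q → trans (*-congʳ (a≈0 q)) (zeroˡ _)) (excursion-identity t))
          where
          a≈0 : ∀ q → a θ q ≈ 0#
          a≈0 q = antisym (≤-trans (IsSum-term (a-mass θ) q) (≤-reflexive p≈0)) (a-nonNeg θ q)

        mean≉0 : ¬ (psum θ p ≈ 0#)
        mean≉0 mean≈0 = proj₂ (positive ≤-refl (≤-trans (≤-reflexive (+-identityˡ 1#)) 1≤)) (sym mean≈0)
          where
          1≤ : 1# ≤ psum θ p
          1≤ = linear₂ (≤-reflexive (sym p-0)) (psum-nonNeg t (λ k → IsSum-nonNeg (a-mass (suc k))))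
                 (solve 2 (λ x y → x :+ y :- :1 := (x :- :1) :+ (y :- :0)) refl (p 0) (psum t (p ∘ suc)))

        bias : ∀ {m} → m ≈ psum θ p → (1# - p θ) / m - π i ≈ p θ / m * (Γ π i θ - 1#)
        bias {m} m≈ = sym (begin
          p θ * m ⁻¹ * (Γ π i θ - 1#)
            ≈⟨ solve 3 (λ p m g → p :* m :* (g :- :1) := (p :* g :- p) :* m) refl (p θ) (m ⁻¹) (Γ π i θ) ⟩
          (p θ * Γ π i θ - p θ) * m ⁻¹
            ≈⟨ *-congʳ (+-congʳ (trans p*Γ (+-congˡ (-‿cong (*-congˡ (sym m≈)))))) ⟩
          (1# - π i * m - p θ) * m ⁻¹
            ≈⟨ solve 4 (λ o π m p → (:1 :- π :* m :- p) :* o := (:1 :- p) :* o :- π :* (m :* o)) refl (m ⁻¹) (π i) m (p θ) ⟩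
          (1# - p θ) * m ⁻¹ - π i * (m * m ⁻¹)
            ≈⟨ +-congˡ (-‿cong (trans (*-congˡ (⁻¹-inverse m λ m≈0 → mean≉0 (trans (sym m≈) m≈0))) (*-identityʳ _))) ⟩
          (1# - p θ) * m ⁻¹ - π i ∎)
          where open import Relation.Binary.Reasoning.Setoid setoid

  -- The threshold has the form `suc t` because the excursion identity concerns positive times; at θ
  -- = 0 the mean, by which the formula divides, would be 0.
  lemma11-θ : (S : Set) → Countable S → (P : S → S → ℝ) → IsTransitionMatrix P → (chain : MarkovChain P) →
    let open MarkovChain chain in
    PositiveRecurrent → (π : S → ℝ) → (i : S) → (∀ j → Convergent (fundamentalTerm P π j i)) →
    (θ : ℕ) → 1 ℕ.≤ θ → (N : ℕ) → 1 ℕ.≤ N → (samples : Samples i θ N) →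
    let p  = ℙ[ i ] (T[ i ]> θ)
        ET̂ = Samples.𝔼[T̂] samples
    in
    Summable (Γ-term π i θ) ∧ ((1# - p) / ET̂ - π i ≈ p / ET̂ * (Γ π i θ - 1#))
  lemma11-θ S countable P isTM chain recurrent π i converges (suc t) _ (suc N) _ samples =
    Γ-summable recurrent π i converges t , bias recurrent π i converges t (SampleMean.𝔼[T̂]≈ countable isTM chain i (suc t) N samples)
    where open Bias countable isTM chain

lemma11 :
  (em : ExcludedMiddle (lsuc 0ℓ)) (R : CompleteOrderedField) →
  let open CompleteOrderedField R
      open Theory em R
  in
  (S : Set) → Countable S →
  (P : S → S → ℝ) → IsTransitionMatrix P →
  (chain : MarkovChain P) →
  let open MarkovChain chain in
  Irreducible P → PositiveRecurrent →
  (π : S → ℝ) → IsStationary P π →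
  (i : S) →
  (∀ j → Convergent (fundamentalTerm P π j i)) →
  (k : ℕ) → 1 ℕ.≤ k →
  (N : ℕ) → 1 ℕ.≤ N → (samples : Samples i θ⟨ k ⟩ N) →
  let p  = ℙ[ i ] (T[ i ]> θ⟨ k ⟩)
      ET̂ = Samples.𝔼[T̂] samples
  in
  Summable (Γ-term π i θ⟨ k ⟩) ∧
  ((1# - p) / ET̂ - π i ≈ p / ET̂ * (Γ π i θ⟨ k ⟩ - 1#))
lemma11 em R S countable P isTM chain _ recurrent π _ i converges k _ N 1≤N samples =
  lemma11-θ S countable P isTM chain recurrent π i converges θ⟨ k ⟩ (ℕₚ.m^n>0 2 k) N 1≤N samples
  where
  open Estimator em R
  open Theory em R using (θ⟨_⟩)
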